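{- Each loop threshold graph is Hoffman-London. Furthermore, if $H$ is a loop threshold graph, then $H$ is strongly Hoffman-London if and only if, after removing all isolated vertices from $H$, the resulting graph is neither empty nor a fully looped complete graph.
   Context: Let $K_1$ be the graph on one vertex with no edges and $K_1^{\circ}$ the graph on one vertex with a loop. The family of loop threshold graphs is the minimal (by inclusion) family of graphs that includes $K_1$ and $K_1^{\circ}$, is closed under adding isolated (unlooped) vertices, and is closed under adding looped dominating vertices (a new vertex with a loop that is adjacent to all other vertices). In the statement about removing isolated vertices, a vertex $v$ is considered isolated if $N(v)\subseteq\{v\}$, so a single vertex with a loop and no other neighbor is also isolated. An empty graph is one with no edges (possibly with no vertices). A fully looped complete graph is a graph in which every two distinct vertices are adjacent and every vertex has a loop. For a target graph $H$ (finite, no multiple edges, possibly with loops) and a simple loopless graph $G$, an $H$-coloring of $G$ is a map $f:V(G)\to V(H)$ such that $f(u)\sim_H f(v)$ whenever $u\sim_G v$; $\hom(G,H)$ denotes the number of $H$-colorings of $G$. $\mathcal{T}_n$ is the set of all trees on $n$ vertices (up to isomorphism) and $P_n\in\mathcal{T}_n$ is the path on $n$ vertices. $H$ is Hoffman-London if for all $n\ge 1$, $\hom(P_n,H)=\min_{T_n\in\mathcal{T}_n}\hom(T_n,H)$; $H$ is strongly Hoffman-London if $\hom(P_n,H)<\hom(T_n,H)$ for all $n\ge 1$ and all $T_n\in\mathcal{T}_n\setminus\{P_n\}$. -}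

module Defs where

open import Data.Empty using (⊥; ⊥-elim)
open import Data.Fin using (Fin; zero; suc; toℕ; fromℕ; inject₁; finToFun)
open import Data.Fin.Properties using (all?) renaming (_≟_ to _≟ᶠ_)
open import Data.List using (List; length; filter; allFin; lookup)
open import Data.Nat using (ℕ; zero; suc; _+_; _^_; _≤_; _<_; _≥_)
open import Data.Nat.Properties using (_≟_)
open import Data.Product using (_×_; ∃-syntax)
open import Data.Sum using (_⊎_; swap)
open import Data.Unit using (⊤; tt)
open import Function using (_↔_; _⇔_; Inverse; Injective; _∘_)
open import Level using (0ℓ)
open import Relation.Binary using (Rel; Symmetric; Decidable)
open import Relation.Binary.Construct.Closure.ReflexiveTransitive using (Star)
open import Relation.Binary.PropositionalEquality using (_≡_; _≢_)
import Relation.Unary as U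
open import Relation.Nullary using (¬_; yes; no)
open import Relation.Nullary.Decidable using (¬?; _→-dec_; _⊎-dec_)

-- Loops are allowed: u ~ u means that u carries a loop.
record Graph (n : ℕ) : Set₁ where
  infix 4 _~_ _~?_
  field
    _~_   : Rel (Fin n) 0ℓ
    ~-sym : Symmetric _~_
    _~?_  : Decidable _~_

open Graph public using () renaming (_~_ to Adj; _~?_ to adj?)

infix 4 _≅_

record _≅_ {m n : ℕ} (G : Graph m) (H : Graph n) : Set where
  field
    bijection : Fin m ↔ Fin n
    adjacency : ∀ u v → Adj G u v ⇔ Adj H (Inverse.to bijection u) (Inverse.to bijection v)

K₁ : Graph 1
K₁ = record
  { _~_   = λ _ _ → ⊥
  ; ~-sym = λ ()
  ; _~?_  = λ _ _ → no λ ()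
  }

K₁° : Graph 1
K₁° = record
  { _~_   = λ _ _ → ⊤
  ; ~-sym = λ _ → tt
  ; _~?_  = λ _ _ → yes tt
  }

-- In both extensions the new vertex is zero.
addIsolated : ∀ {n} → Graph n → Graph (suc n)
addIsolated {n} G = record { _~_ = _~′_ ; ~-sym = λ {u} {v} → sym′ u v ; _~?_ = dec′ }
  where
  _~′_ : Rel (Fin (suc n)) 0ℓ
  suc u ~′ suc v = Adj G u v
  zero  ~′ _     = ⊥
  suc _ ~′ zero  = ⊥

  sym′ : ∀ u v → u ~′ v → v ~′ u
  sym′ (suc u) (suc v) = Graph.~-sym G
  sym′ zero    _       = ⊥-elim
  sym′ (suc _) zero    = ⊥-elim

  dec′ : Decidable _~′_
  dec′ (suc u) (suc v) = adj? G u v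
  dec′ zero    _       = no λ ()
  dec′ (suc _) zero    = no λ ()

addLoopedDominating : ∀ {n} → Graph n → Graph (suc n)
addLoopedDominating {n} G = record { _~_ = _~′_ ; ~-sym = λ {u} {v} → sym′ u v ; _~?_ = dec′ }
  where
  _~′_ : Rel (Fin (suc n)) 0ℓ
  suc u ~′ suc v = Adj G u v
  zero  ~′ _     = ⊤
  suc _ ~′ zero  = ⊤

  sym′ : ∀ u v → u ~′ v → v ~′ u
  sym′ (suc u) (suc v) = Graph.~-sym G
  sym′ zero    zero    = λ _ → tt
  sym′ zero    (suc _) = λ _ → tt
  sym′ (suc _) zero    = λ _ → tt

  dec′ : Decidable _~′_
  dec′ (suc u) (suc v) = adj? G u v
  dec′ zero    _       = yes tt
  dec′ (suc _) zero    = yes tt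

-- Families of graphs are closed under isomorphism, hence the last constructor.
data LoopThreshold : ∀ {n} → Graph n → Set₁ where
  base       : LoopThreshold K₁
  base°      : LoopThreshold K₁°
  isolated   : ∀ {n} {G : Graph n} → LoopThreshold G → LoopThreshold (addIsolated G)
  dominating : ∀ {n} {G : Graph n} → LoopThreshold G → LoopThreshold (addLoopedDominating G)
  iso        : ∀ {m n} {G : Graph m} {H : Graph n} → G ≅ H → LoopThreshold G → LoopThreshold H

-- N(v) ⊆ {v}, so a looped vertex with no other neighbour counts as isolated.
Isolated : ∀ {n} → Graph n → Fin n → Set
Isolated H v = ∀ w → Adj H v w → w ≡ v

isolated? : ∀ {n} (H : Graph n) → U.Decidable (Isolated H)
isolated? H v = all? λ w → adj? H v w →-dec (w ≟ᶠ v)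

-- The subgraph induced on a list of vertices; used only for lists without
-- repetition.
induced : ∀ {n} → Graph n → (vs : List (Fin n)) → Graph (length vs)
induced H vs = record
  { _~_   = λ i j → Adj H (lookup vs i) (lookup vs j)
  ; ~-sym = Graph.~-sym H
  ; _~?_  = λ i j → adj? H (lookup vs i) (lookup vs j)
  }

nonIsolated : ∀ {n} → Graph n → List (Fin n)
nonIsolated {n} H = filter (¬? ∘ isolated? H) (allFin n)

removeIsolated : ∀ {n} (H : Graph n) → Graph (length (nonIsolated H))
removeIsolated H = induced H (nonIsolated H)

Empty : ∀ {n} → Graph n → Set
Empty G = ∀ u v → ¬ Adj G u v

FullyLoopedComplete : ∀ {n} → Graph n → Set
FullyLoopedComplete G = (∀ u v → u ≢ v → Adj G u v) × (∀ v → Adj G v v)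

Loopless : ∀ {n} → Graph n → Set
Loopless G = ∀ v → ¬ Adj G v v

Connected : ∀ {n} → Graph n → Set
Connected G = ∀ u v → Star (Adj G) u v

-- A cycle of length 3 + k, given by its distinct vertices in cyclic order.
record Cycle {n : ℕ} (G : Graph n) : Set where
  field
    k        : ℕ
    vertex   : Fin (3 + k) → Fin n
    distinct : Injective _≡_ _≡_ vertex
    step     : ∀ (i : Fin (2 + k)) → Adj G (vertex (inject₁ i)) (vertex (suc i))
    close    : Adj G (vertex (fromℕ (2 + k))) (vertex zero)

-- Nonemptiness is not a field: trees are only considered for n ≥ 1.
record Tree (n : ℕ) : Set₁ where
  field
    graph     : Graph n
    loopless  : Loopless graph
    connected : Connected graph
    acyclic   : ¬ Cycle graph

path : ∀ n → Graph n
path n = record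
  { _~_   = λ u v → toℕ v ≡ suc (toℕ u) ⊎ toℕ u ≡ suc (toℕ v)
  ; ~-sym = swap
  ; _~?_  = λ u v → (toℕ v ≟ suc (toℕ u)) ⊎-dec (toℕ u ≟ suc (toℕ v))
  }

IsColoring : ∀ {m n} → Graph m → Graph n → (Fin m → Fin n) → Set
IsColoring G H f = ∀ u v → Adj G u v → Adj H (f u) (f v)

isColoring? : ∀ {m n} (G : Graph m) (H : Graph n) → U.Decidable (IsColoring G H)
isColoring? G H f = all? λ u → all? λ v → adj? G u v →-dec adj? H (f u) (f v)

-- finToFun : Fin (n ^ m) → (Fin m → Fin n) enumerates every map exactly once.
hom : ∀ {m n} → Graph m → Graph n → ℕ
hom {m} {n} G H = length (filter (isColoring? G H ∘ finToFun) (allFin (n ^ m)))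

IsMinimum : ∀ {a} {A : Set a} → (A → ℕ) → ℕ → Set a
IsMinimum f x = (∃[ a ] f a ≡ x) × (∀ a → x ≤ f a)

HoffmanLondon : ∀ {k} → Graph k → Set₁
HoffmanLondon H = ∀ n → n ≥ 1 →
  IsMinimum (λ (T : Tree n) → hom (Tree.graph T) H) (hom (path n) H)

StronglyHoffmanLondon : ∀ {k} → Graph k → Set₁
StronglyHoffmanLondon H = ∀ n → n ≥ 1 → (T : Tree n) → ¬ (Tree.graph T ≅ path n) →
  hom (path n) H < hom (Tree.graph T) H

{-# OPTIONS --safe #-}

-- In a loop threshold graph H any two neighbourhoods are comparable, so the
-- number of colourings of a rooted tree is a monotone function of the colour of
-- the root, ordered by N(x) ⊆ N(y).  Let p_c(x) be the number of walks of
-- length c from x.  Chebyshev's inequality for the symmetric kernel counting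
-- walks of length c gives Σ r p_{b+c} ≤ Σ r p_b p_c for every monotone r:
-- merging two pendant paths of a tree into one does not create colourings.
-- Pruning leaves one by one, this bounds hom(T, H) below by the number of
-- colourings of a spider centred at any chosen vertex v with deg v legs, and
-- then by hom(P_n, H).  If v has degree at least 3, the last step is strict as
-- soon as adjacency in H is not transitive: for x ~ y ~ z with x ≁ z, the pair
-- x, y makes Chebyshev's inequality strict.  If adjacency in H is transitive, a
-- colouring of a tree is a tuple of pairwise adjacent vertices, whatever the tree.
-- Transitivity means that the non-isolated part of H is fully looped complete,
-- possibly without vertices; it has no vertices as soon as it has no edges.
module Submission where

open import Algebra.Bundles using (CommutativeMonoid)
import Algebra.Properties.CommutativeMonoid.Sum as CommutativeMonoidSum
open import Data.Fin
  using (Fin; zero; suc; toℕ; fromℕ; fromℕ<; inject₁; punchIn; punchOut; finToFun; combine; _↑ˡ_; _↑ʳ_)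
open import Data.Fin.Induction using (<-weakInduction)
open import Data.Fin.Properties
  using ( toℕ-injective; toℕ-fromℕ; toℕ-fromℕ<; toℕ-inject₁; toℕ<n; fromℕ<-injective; injective⇒≤; remQuot-combine
        ; punchInᵢ≢i; punchIn-injective; punchIn-punchOut; punchOut-injective; any?; all?; ¬∀⟶∃¬)
  renaming (_≟_ to _≟ᶠ_)
open import Data.Fin.Relation.Unary.Top using (view; ‵fromℕ; ‵inject₁)
open import Data.List using (List; []; _∷_; length; filter; tabulate; allFin; lookup)
open import Data.List.Membership.Propositional using (_∈_)
open import Data.List.Membership.Propositional.Properties using (∈-filter⁺; ∈-filter⁻; ∈-lookup; ∈-allFin)
import Data.List.Relation.Unary.Any as Any
open import Data.List.Relation.Unary.Any.Properties using (lookup-index)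
open import Data.Nat hiding (_≟_)
open import Data.Nat.Properties hiding (_≟_)
open import Data.Nat.Solver using (module +-*-Solver)
open import Data.Product using (_×_; _,_; proj₁; proj₂; ∃-syntax)
open import Data.Sum as Sum using (_⊎_; inj₁; inj₂)
open import Data.Vec.Functional as Vector using (Vector; insertAt; removeAt; updateAt; tail)
open import Data.Vec.Functional.Properties using (insertAt-lookup; insertAt-punchIn; updateAt-updates; updateAt-minimal)
open import Function using (_∘_; _⇔_; Equivalence; Injection; Inverse; mk⇔; mk↔ₛ′)
open import Function.Properties.Inverse using (↔⇒↣)
open import Level using (0ℓ)
open import Relation.Binary using (Transitive; tri<; tri≈; tri>)
open import Relation.Binary.Construct.Closure.ReflexiveTransitive as Closure using (Star; ε; _◅_; _◅◅_)
open import Relation.Binary.PropositionalEquality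
open import Relation.Nullary using (¬_; Dec; yes; no; contradiction)
open import Relation.Nullary.Decidable using (_×-dec_; _⊎-dec_; ¬?; map′; decidable-stable)
open import Relation.Unary using (Pred; Decidable)

open import Algebra.Properties.CommutativeSemigroup *-commutativeSemigroup using (x∙yz≈y∙xz; x∙yz≈xz∙y; xy∙z≈xz∙y)
import Algebra.Properties.Semiring.Sum +-*-semiring as SemiringSum
open SemiringSum using (sum; sum-cong-≗)
open CommutativeMonoidSum *-1-commutativeMonoid
  using () renaming (sum to ∏; sum-cong-≗ to ∏-cong; sum-remove to ∏-remove)

open import Defs

-- Sums over finite types and over maps

private variable
  k m n : ℕ

module _ {c ℓ} (M : CommutativeMonoid c ℓ) where
  open CommutativeMonoid M renaming (refl to ≈-refl; sym to ≈-sym; trans to ≈-trans)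
  open CommutativeMonoidSum M using () renaming (sum to ⨁)
  open import Algebra.Properties.CommutativeSemigroup commutativeSemigroup using () renaming (x∙yz≈y∙xz to ∙-left-comm)

  -- Stated for any commutative monoid because pruning changes one entry of a family of branches
  -- both in a sum of sizes and in a product of weights.
  sum-updateAt : ∀ {a} {A : Set a} (φ : Fin n → A → Carrier) (t : Vector A n) (u : Fin n) (h : A → A) {x} →
    φ u (h (t u)) ≈ x ∙ φ u (t u) →
    ⨁ (λ i → φ i (updateAt t u h i)) ≈ x ∙ ⨁ (λ i → φ i (t i))
  sum-updateAt φ t zero    h eq = ≈-trans (∙-congʳ eq) (assoc _ _ _)
  sum-updateAt φ t (suc u) h eq =
    ≈-trans (∙-congˡ (sum-updateAt (φ ∘ suc) (tail t) u h eq)) (∙-left-comm _ _ _)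

-- Opaque, so that unification can recover the summand from a sum.
opaque
  ∑ : (Fin n → ℕ) → ℕ
  ∑ = sum

∑-syntax : ∀ n → (Fin n → ℕ) → ℕ
∑-syntax n f = ∑ f

infixl 10 ∑-syntax
syntax ∑-syntax n (λ i → e) = ∑[ i < n ] e

opaque
  unfolding ∑

  ∑-empty : ∀ (f : Fin 0 → ℕ) → ∑ f ≡ 0
  ∑-empty f = refl

  ∑-suc : ∀ (f : Fin (suc n) → ℕ) → ∑ f ≡ f zero + ∑ (f ∘ suc)
  ∑-suc f = refl

  ∑-cong : ∀ {f g : Fin n → ℕ} → f ≗ g → ∑ f ≡ ∑ g
  ∑-cong = sum-cong-≗

  ∑-comm : ∀ (f : Fin m → Fin n → ℕ) → ∑[ i < m ] ∑[ j < n ] f i j ≡ ∑[ j < n ] ∑[ i < m ] f i j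
  ∑-comm = SemiringSum.∑-comm

  ∑-distrib-+ : ∀ (f g : Fin n → ℕ) → ∑[ i < n ] (f i + g i) ≡ ∑ f + ∑ g
  ∑-distrib-+ = SemiringSum.∑-distrib-+

  *-distribˡ-∑ : ∀ x (f : Fin n → ℕ) → x * ∑ f ≡ ∑[ i < n ] (x * f i)
  *-distribˡ-∑ = SemiringSum.*-distribˡ-sum

  *-distribʳ-∑ : ∀ x (f : Fin n → ℕ) → ∑ f * x ≡ ∑[ i < n ] (f i * x)
  *-distribʳ-∑ = SemiringSum.*-distribʳ-sum

  ∑-remove : ∀ i (f : Fin (suc n) → ℕ) → ∑ f ≡ f i + ∑ (removeAt f i)
  ∑-remove i f = SemiringSum.sum-remove f

  ∑-updateAt : ∀ {A : Set} (φ : A → ℕ) (t : Vector A n) u (h : A → A) {x} →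
    φ (h (t u)) ≡ x + φ (t u) → ∑ (φ ∘ updateAt t u h) ≡ x + ∑ (φ ∘ t)
  ∑-updateAt φ = sum-updateAt +-0-commutativeMonoid λ _ → φ

  ∑-mono-≤ : ∀ {f g : Fin n → ℕ} → (∀ i → f i ≤ g i) → ∑ f ≤ ∑ g
  ∑-mono-≤ {zero}  f≤g = z≤n
  ∑-mono-≤ {suc n} f≤g = +-mono-≤ (f≤g zero) (∑-mono-≤ (f≤g ∘ suc))

  ∑-mono-< : ∀ {f g : Fin n → ℕ} → (∀ i → f i ≤ g i) → ∀ i → f i < g i → ∑ f < ∑ g
  ∑-mono-< f≤g zero    f<g = +-mono-<-≤ f<g (∑-mono-≤ (f≤g ∘ suc))
  ∑-mono-< f≤g (suc i) f<g = +-mono-≤-< (f≤g zero) (∑-mono-< (f≤g ∘ suc) i f<g)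

  term≤∑ : ∀ (f : Fin n → ℕ) i → f i ≤ ∑ f
  term≤∑ f zero    = m≤m+n _ _
  term≤∑ f (suc i) = ≤-trans (term≤∑ (f ∘ suc) i) (m≤n+m _ _)

  ∑-zero : ∀ {f : Fin n → ℕ} → (∀ i → f i ≡ 0) → ∑ f ≡ 0
  ∑-zero {zero}  f≡0 = refl
  ∑-zero {suc n} f≡0 = cong₂ _+_ (f≡0 zero) (∑-zero (f≡0 ∘ suc))

𝟙 : ∀ {P : Set} → Dec P → ℕ
𝟙 (yes _) = 1
𝟙 (no  _) = 0

𝟙-yes : ∀ {P : Set} (d : Dec P) → P → 𝟙 d ≡ 1
𝟙-yes (yes _) p = refl
𝟙-yes (no ¬p) p = contradiction p ¬p

𝟙-no : ∀ {P : Set} (d : Dec P) → ¬ P → 𝟙 d ≡ 0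
𝟙-no (yes p) ¬p = contradiction p ¬p
𝟙-no (no _)  ¬p = refl

𝟙-mono : ∀ {P Q : Set} (d : Dec P) (e : Dec Q) → (P → Q) → 𝟙 d ≤ 𝟙 e
𝟙-mono (yes p) e P⇒Q = ≤-reflexive (sym (𝟙-yes e (P⇒Q p)))
𝟙-mono (no _)  e P⇒Q = z≤n

𝟙-cong : ∀ {P Q : Set} (d : Dec P) (e : Dec Q) → (P → Q) → (Q → P) → 𝟙 d ≡ 𝟙 e
𝟙-cong d e P⇒Q Q⇒P = ≤-antisym (𝟙-mono d e P⇒Q) (𝟙-mono e d Q⇒P)

𝟙-× : ∀ {P Q : Set} (d : Dec P) (e : Dec Q) → 𝟙 (d ×-dec e) ≡ 𝟙 d * 𝟙 e
𝟙-× (yes _) (yes _) = refl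
𝟙-× (yes _) (no _)  = refl
𝟙-× (no _)  e       = refl

∑-δ : ∀ (j : Fin n) (f : Fin n → ℕ) → ∑[ i < n ] (𝟙 (j ≟ᶠ i) * f i) ≡ f j
∑-δ {suc n} j f = begin
  ∑[ i < suc n ] (𝟙 (j ≟ᶠ i) * f i)                  ≡⟨ ∑-remove j (λ i → 𝟙 (j ≟ᶠ i) * f i) ⟩
  𝟙 (j ≟ᶠ j) * f j + ∑[ i < n ] (𝟙 (j ≟ᶠ punchIn j i) * f (punchIn j i))
    ≡⟨ cong₂ _+_ (cong (_* f j) (𝟙-yes (j ≟ᶠ j) refl))
                 (∑-zero λ i → cong (_* f (punchIn j i)) (𝟙-no (j ≟ᶠ punchIn j i) (punchInᵢ≢i j i ∘ sym))) ⟩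
  1 * f j + 0                                      ≡⟨ trans (+-identityʳ _) (*-identityˡ _) ⟩
  f j                                              ∎
  where
  open ≡-Reasoning

length-filter-tabulate : ∀ {A : Set} {P : Pred A 0ℓ} (P? : Decidable P) (h : Fin n → A) →
  length (filter P? (tabulate h)) ≡ ∑[ i < n ] 𝟙 (P? (h i))
length-filter-tabulate {zero}  P? h = sym (∑-empty _)
length-filter-tabulate {suc n} P? h = trans head (sym (∑-suc λ i → 𝟙 (P? (h i))))
  where
  head : length (filter P? (tabulate h)) ≡ 𝟙 (P? (h zero)) + ∑[ i < n ] 𝟙 (P? (h (suc i)))
  head with P? (h zero)
  ... | yes _ = cong suc (length-filter-tabulate P? (h ∘ suc))
  ... | no  _ = length-filter-tabulate P? (h ∘ suc)

opaque
  unfolding ∑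

  ∑-↑ : ∀ (f : Fin (m + n) → ℕ) → ∑ f ≡ ∑[ i < m ] f (i ↑ˡ n) + ∑[ j < n ] f (m ↑ʳ j)
  ∑-↑ {zero}  f = refl
  ∑-↑ {suc m} f = trans (cong (f zero +_) (∑-↑ {m} (f ∘ suc))) (sym (+-assoc (f zero) _ _))

  ∑-combine : ∀ (f : Fin (m * n) → ℕ) → ∑ f ≡ ∑[ i < m ] ∑[ j < n ] f (combine i j)
  ∑-combine {zero}      f = refl
  ∑-combine {suc m} {n} f = trans (∑-↑ {n} f) (cong (∑ (λ j → f (j ↑ˡ m * n)) +_) (∑-combine {m} (f ∘ (n ↑ʳ_))))

  ∑-one : ∀ (f : Fin 1 → ℕ) → ∑ f ≡ f zero
  ∑-one f = +-identityʳ _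

-- Maps are compared pointwise only, so a summand over maps has to respect pointwise equality before
-- its argument may be rewritten.
Extensional : ((Fin m → Fin k) → ℕ) → Set
Extensional F = ∀ {f g} → f ≗ g → F f ≡ F g

-- Recursion on the domain replaces the encoding of maps as elements of `Fin (k ^ m)`, so that a
-- single coordinate can be summed out.
sumMaps : ∀ m → ((Fin m → Fin k) → ℕ) → ℕ
sumMaps         zero    F = F λ ()
sumMaps {k = k} (suc m) F = sumMaps m λ g → ∑[ y < k ] F (y Vector.∷ g)

sumMaps-cong : ∀ m {F G : (Fin m → Fin k) → ℕ} → F ≗ G → sumMaps m F ≡ sumMaps m G
sumMaps-cong zero    F≗G = F≗G _
sumMaps-cong (suc m) F≗G = sumMaps-cong m λ g → ∑-cong λ y → F≗G (y Vector.∷ g)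

∷-cong : ∀ {f g : Fin m → Fin k} y → f ≗ g → (y Vector.∷ f) ≗ (y Vector.∷ g)
∷-cong y f≗g zero    = refl
∷-cong y f≗g (suc i) = f≗g i

∑-∷-extensional : ∀ {F : (Fin (suc m) → Fin k) → ℕ} → Extensional F →
  Extensional (λ g → ∑[ y < k ] F (y Vector.∷ g))
∑-∷-extensional F-ext f≗g = ∑-cong λ y → F-ext (∷-cong y f≗g)

-- `combine` separates the leading base-`k` digit of the code of a map, which is its value at
-- `zero`, from the code of the rest.
∑-finToFun : ∀ m (F : (Fin m → Fin k) → ℕ) → Extensional F →
  ∑[ i < k ^ m ] F (finToFun i) ≡ sumMaps m F
∑-finToFun zero    F F-ext = trans (∑-one _) (F-ext λ ())
∑-finToFun {k} (suc m) F F-ext = begin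
  ∑[ i < k ^ suc m ] F (finToFun i)                              ≡⟨ ∑-combine {k} _ ⟩
  ∑[ y < k ] ∑[ j < k ^ m ] F (finToFun (combine y j))           ≡⟨ ∑-cong (λ y → ∑-cong λ j → F-ext (finToFun-combine y j)) ⟩
  ∑[ y < k ] ∑[ j < k ^ m ] F (y Vector.∷ finToFun j)                   ≡⟨ ∑-comm {k} {k ^ m} (λ y j → F (y Vector.∷ finToFun j)) ⟩
  ∑[ j < k ^ m ] ∑[ y < k ] F (y Vector.∷ finToFun j)                   ≡⟨ ∑-finToFun m _ (∑-∷-extensional F-ext) ⟩
  sumMaps (suc m) F                                              ∎
  where
  open ≡-Reasoning
  finToFun-combine : ∀ y j → finToFun {k} {suc m} (combine y j) ≗ (y Vector.∷ finToFun j)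
  finToFun-combine y j zero    = cong proj₁ (remQuot-combine y j)
  finToFun-combine y j (suc i) = cong (λ p → finToFun (proj₂ p) i) (remQuot-combine {k} y j)

-- Finite sums commute, so any coordinate `ℓ` can take the innermost place; this is how the colour
-- of a leaf is summed out first.
sumMaps-insertAt : ∀ (ℓ : Fin (suc m)) (F : (Fin (suc m) → Fin k) → ℕ) → Extensional F →
  sumMaps (suc m) F ≡ sumMaps m (λ g → ∑[ y < k ] F (insertAt g ℓ y))
sumMaps-insertAt {m} zero F F-ext = sumMaps-cong m λ g → ∑-cong λ y → F-ext (insertAt-zero g y)
  where
  insertAt-zero : ∀ g y → (y Vector.∷ g) ≗ insertAt g zero y
  insertAt-zero g y zero    = refl
  insertAt-zero g y (suc i) = refl
sumMaps-insertAt {suc m} {k} (suc ℓ) F F-ext = begin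
  sumMaps (suc m) (λ g → ∑[ z < k ] F (z Vector.∷ g))
    ≡⟨ sumMaps-insertAt ℓ _ (∑-∷-extensional F-ext) ⟩
  sumMaps m (λ g → ∑[ y < k ] ∑[ z < k ] F (z Vector.∷ insertAt g ℓ y))
    ≡⟨ sumMaps-cong m (λ g → ∑-comm λ y z → F (z Vector.∷ insertAt g ℓ y)) ⟩
  sumMaps m (λ g → ∑[ z < k ] ∑[ y < k ] F (z Vector.∷ insertAt g ℓ y))
    ≡⟨ sumMaps-cong m (λ g → ∑-cong λ z → ∑-cong λ y → F-ext (insertAt-suc g y z)) ⟩
  sumMaps m (λ g → ∑[ z < k ] ∑[ y < k ] F (insertAt (z Vector.∷ g) (suc ℓ) y))
    ∎
  where
  open ≡-Reasoning
  insertAt-suc : ∀ g y z → (z Vector.∷ insertAt g ℓ y) ≗ insertAt (z Vector.∷ g) (suc ℓ) y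
  insertAt-suc g y z zero    = refl
  insertAt-suc g y z (suc i) = refl

-- Walks in a graph with nested neighbourhoods

infix 4 _⊢_⊑_

_⊢_⊑_ : ∀ {k} (H : Graph k) → Fin k → Fin k → Set
H ⊢ u ⊑ v = ∀ w → Adj H u w → Adj H v w

Nested : ∀ {k} → Graph k → Set
Nested H = ∀ u v → H ⊢ u ⊑ v ⊎ H ⊢ v ⊑ u

addIsolated-nested : ∀ {k} {H : Graph k} → Nested H → Nested (addIsolated H)
addIsolated-nested nested zero    v       = inj₁ λ _ ()
addIsolated-nested nested (suc u) zero    = inj₂ λ _ ()
addIsolated-nested nested (suc u) (suc v) with nested u v
... | inj₁ u⊑v = inj₁ λ { (suc w) → u⊑v w }
... | inj₂ v⊑u = inj₂ λ { (suc w) → v⊑u w }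

addLoopedDominating-nested : ∀ {k} {H : Graph k} → Nested H → Nested (addLoopedDominating H)
addLoopedDominating-nested nested zero    v       = inj₂ λ _ _ → _
addLoopedDominating-nested nested (suc u) zero    = inj₁ λ _ _ → _
addLoopedDominating-nested nested (suc u) (suc v) with nested u v
... | inj₁ u⊑v = inj₁ λ { zero → λ _ → _ ; (suc w) → u⊑v w }
... | inj₂ v⊑u = inj₂ λ { zero → λ _ → _ ; (suc w) → v⊑u w }

≅-nested : ∀ {k l} {G : Graph k} {H : Graph l} → G ≅ H → Nested G → Nested H
≅-nested {G = G} {H} G≅H nested u v = Sum.map transfer transfer (nested (from u) (from v))
  where
  open _≅_ G≅H
  open Inverse bijection using (to; from; strictlyInverseˡ)

  transfer : ∀ {u v} → G ⊢ from u ⊑ from v → H ⊢ u ⊑ v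
  transfer {u} {v} ⊑ w u~w =
    subst₂ (Adj H) (strictlyInverseˡ v) (strictlyInverseˡ w)
      (Equivalence.to (adjacency (from v) (from w))
        (⊑ (from w)
          (Equivalence.from (adjacency (from u) (from w))
            (subst₂ (Adj H) (sym (strictlyInverseˡ u)) (sym (strictlyInverseˡ w)) u~w))))

-- A new isolated vertex has the least neighbourhood and a new looped dominating vertex the
-- greatest, so neither construction creates an incomparable pair.
loopThreshold⇒nested : ∀ {k} {H : Graph k} → LoopThreshold H → Nested H
loopThreshold⇒nested base               = λ _ _ → inj₁ λ _ ()
loopThreshold⇒nested base°              = λ _ _ → inj₁ λ _ _ → _
loopThreshold⇒nested (isolated LT)      = addIsolated-nested (loopThreshold⇒nested LT)
loopThreshold⇒nested (dominating LT)    = addLoopedDominating-nested (loopThreshold⇒nested LT)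
loopThreshold⇒nested (iso G≅H LT)       = ≅-nested G≅H (loopThreshold⇒nested LT)

-- The two sides differ by `(b - a) * (d - c)`, which appears as `e * f` once `b` and `d` are
-- written as `a + e` and `c + f`.
rearrangement : ∀ {a b c d} → a ≤ b → c ≤ d → a * d + b * c ≤ a * c + b * d
rearrangement {a} {c = c} a≤b c≤d with m≤n⇒∃[o]m+o≡n a≤b | m≤n⇒∃[o]m+o≡n c≤d
... | e , refl | f , refl = subst (a * (c + f) + (a + e) * c ≤_) eq (m≤m+n _ (e * f))
  where
  open +-*-Solver
  eq : a * (c + f) + (a + e) * c + e * f ≡ a * c + (a + e) * (c + f)
  eq = solve 4 (λ a c e f → a :* (c :+ f) :+ (a :+ e) :* c :+ e :* f := a :* c :+ (a :+ e) :* (c :+ f)) refl a c e f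

rearrangement-< : ∀ {a b c d} → a < b → c < d → a * d + b * c < a * c + b * d
rearrangement-< {a} {c = c} a<b c<d with m≤n⇒∃[o]m+o≡n a<b | m≤n⇒∃[o]m+o≡n c<d
... | e , refl | f , refl = subst (a * (suc c + f) + (suc a + e) * c <_) eq (m<m+n _ z<s)
  where
  open +-*-Solver
  eq : a * (suc c + f) + (suc a + e) * c + suc e * suc f ≡ a * c + (suc a + e) * (suc c + f)
  eq = solve 4 (λ a c e f → a :* (con 1 :+ c :+ f) :+ (con 1 :+ a :+ e) :* c :+ (con 1 :+ e) :* (con 1 :+ f)
                              := a :* c :+ (con 1 :+ a :+ e) :* (con 1 :+ c :+ f)) refl a c e f

module Walks {k : ℕ} (H : Graph k) where

  infixr 7 _·_
  _·_ : (f g : Fin k → ℕ) → Fin k → ℕ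
  (f · g) x = f x * g x

  edge : Fin k → Fin k → ℕ
  edge x y = 𝟙 (adj? H x y)

  edge-sym : ∀ x y → edge x y ≡ edge y x
  edge-sym x y = 𝟙-cong (adj? H x y) (adj? H y x) (Graph.~-sym H) (Graph.~-sym H)

  -- The adjacency operator of `H`. If `f` counts colourings of a rooted tree by the colour of its
  -- root, `A f` counts them after a new root is joined to the old one by an edge.
  A : (Fin k → ℕ) → Fin k → ℕ
  A f x = ∑[ y < k ] (edge x y * f y)

  walks : ℕ → Fin k → ℕ
  walks zero    x = 1
  walks (suc c) = A (walks c)

  A-cong : ∀ {f g} → f ≗ g → A f ≗ A g
  A-cong f≗g x = ∑-cong λ y → cong (edge x y *_) (f≗g y)

  -- The adjacency matrix is symmetric. Combinatorially, a sum over the colour of one end of an edge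
  -- is rewritten as a sum over the colour of the other end.
  A-adjoint : ∀ f g → ∑ (A f · g) ≡ ∑ (f · A g)
  A-adjoint f g = begin
    ∑[ x < k ] (A f x * g x)                      ≡⟨ ∑-cong (λ x → *-distribʳ-∑ (g x) _) ⟩
    ∑[ x < k ] ∑[ y < k ] (edge x y * f y * g x)  ≡⟨ ∑-comm {k} {k} _ ⟩
    ∑[ y < k ] ∑[ x < k ] (edge x y * f y * g x)  ≡⟨ ∑-cong (λ y → ∑-cong (λ x → swap x y)) ⟩
    ∑[ y < k ] ∑[ x < k ] (f y * (edge y x * g x)) ≡⟨ ∑-cong (λ y → *-distribˡ-∑ (f y) _) ⟨
    ∑[ y < k ] (f y * A g y)                      ∎
    where
    open ≡-Reasoning
    swap : ∀ x y → edge x y * f y * g x ≡ f y * (edge y x * g x)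
    swap x y rewrite edge-sym x y = trans (cong (_* g x) (*-comm (edge y x) (f y))) (*-assoc (f y) _ _)

  walkMatrix : ℕ → Fin k → Fin k → ℕ
  walkMatrix zero    x y = 𝟙 (x ≟ᶠ y)
  walkMatrix (suc c) x y = ∑[ z < k ] (edge x z * walkMatrix c z y)

  -- Peeling off the last step instead of the first is what lets the induction for `walkMatrix-sym`
  -- reverse a walk.
  walkMatrix-sucʳ : ∀ c x y → walkMatrix (suc c) x y ≡ ∑[ z < k ] (walkMatrix c x z * edge z y)
  walkMatrix-sucʳ zero x y = begin
    ∑[ z < k ] (edge x z * 𝟙 (z ≟ᶠ y))  ≡⟨ ∑-cong (λ z → trans (*-comm (edge x z) _) (cong (_* edge x z) (𝟙-cong (z ≟ᶠ y) (y ≟ᶠ z) sym sym))) ⟩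
    ∑[ z < k ] (𝟙 (y ≟ᶠ z) * edge x z)  ≡⟨ ∑-δ y (edge x) ⟩
    edge x y                            ≡⟨ ∑-δ x (λ z → edge z y) ⟨
    ∑[ z < k ] (𝟙 (x ≟ᶠ z) * edge z y)  ∎
    where open ≡-Reasoning
  walkMatrix-sucʳ (suc c) x y = begin
    ∑[ z < k ] (edge x z * walkMatrix (suc c) z y)
      ≡⟨ ∑-cong (λ z → cong (edge x z *_) (walkMatrix-sucʳ c z y)) ⟩
    ∑[ z < k ] (edge x z * ∑[ t < k ] (walkMatrix c z t * edge t y))
      ≡⟨ ∑-cong (λ z → *-distribˡ-∑ (edge x z) _) ⟩
    ∑[ z < k ] ∑[ t < k ] (edge x z * (walkMatrix c z t * edge t y))
      ≡⟨ ∑-comm {k} {k} _ ⟩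
    ∑[ t < k ] ∑[ z < k ] (edge x z * (walkMatrix c z t * edge t y))
      ≡⟨ ∑-cong (λ t → ∑-cong (λ z → *-assoc (edge x z) _ _)) ⟨
    ∑[ t < k ] ∑[ z < k ] (edge x z * walkMatrix c z t * edge t y)
      ≡⟨ ∑-cong (λ t → *-distribʳ-∑ (edge t y) _) ⟨
    ∑[ t < k ] (walkMatrix (suc c) x t * edge t y)
      ∎
    where open ≡-Reasoning

  walkMatrix-sym : ∀ c x y → walkMatrix c x y ≡ walkMatrix c y x
  walkMatrix-sym zero    x y = 𝟙-cong (x ≟ᶠ y) (y ≟ᶠ x) sym sym
  walkMatrix-sym (suc c) x y = begin
    ∑[ z < k ] (edge x z * walkMatrix c z y)  ≡⟨ ∑-cong (λ z → trans (*-comm (edge x z) _) (cong₂ _*_ (walkMatrix-sym c z y) (edge-sym x z))) ⟩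
    ∑[ z < k ] (walkMatrix c y z * edge z x)  ≡⟨ walkMatrix-sucʳ c y x ⟨
    walkMatrix (suc c) y x                    ∎
    where open ≡-Reasoning

  -- A walk of length `c + b` is cut at the vertex `y` that it reaches after `c` steps.
  walks-+ : ∀ c b x → walks (c + b) x ≡ ∑[ y < k ] (walkMatrix c x y * walks b y)
  walks-+ zero    b x = sym (∑-δ x (walks b))
  walks-+ (suc c) b x = begin
    ∑[ z < k ] (edge x z * walks (c + b) z)
      ≡⟨ A-cong (walks-+ c b) x ⟩
    ∑[ z < k ] (edge x z * ∑[ y < k ] (walkMatrix c z y * walks b y))
      ≡⟨ ∑-cong (λ z → trans (*-distribˡ-∑ (edge x z) _) (∑-cong λ y → sym (*-assoc (edge x z) _ _))) ⟩
    ∑[ z < k ] ∑[ y < k ] (edge x z * walkMatrix c z y * walks b y)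
      ≡⟨ ∑-comm {k} {k} _ ⟩
    ∑[ y < k ] ∑[ z < k ] (edge x z * walkMatrix c z y * walks b y)
      ≡⟨ ∑-cong (λ y → *-distribʳ-∑ (walks b y) _) ⟨
    ∑[ y < k ] (walkMatrix (suc c) x y * walks b y)
      ∎
    where open ≡-Reasoning

  -- A single edge suffices: walk back and forth along it.
  walks-pos : ∀ c {x y} → Adj H x y → 1 ≤ walks c x
  walks-pos zero            x~y = ≤-refl
  walks-pos (suc c) {x} {y} x~y = begin
    1                    ≤⟨ walks-pos c (Graph.~-sym H x~y) ⟩
    walks c y            ≡⟨ *-identityˡ _ ⟨
    1 * walks c y        ≡⟨ cong (_* walks c y) (𝟙-yes (adj? H x y) x~y) ⟨
    edge x y * walks c y ≤⟨ term≤∑ (λ z → edge x z * walks c z) y ⟩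
    walks (suc c) x      ∎
    where open ≤-Reasoning

  Monotone : (Fin k → ℕ) → Set
  Monotone f = ∀ {u v} → H ⊢ u ⊑ v → f u ≤ f v

  -- A larger neighbourhood only adds nonnegative terms, so `f` may be arbitrary; `absorb` applies
  -- this to weights that are not known to be monotone.
  A-mono : ∀ f → Monotone (A f)
  A-mono f {u} {v} u⊑v = ∑-mono-≤ λ y → *-monoˡ-≤ (f y) (𝟙-mono (adj? H u y) (adj? H v y) (u⊑v y))

  walks-mono : ∀ c → Monotone (walks c)
  walks-mono zero    _ = ≤-refl
  walks-mono (suc c) = A-mono (walks c)

  ·-mono : ∀ {f g} → Monotone f → Monotone g → Monotone (f · g)
  ·-mono f-mono g-mono u⊑v = *-mono-≤ (f-mono u⊑v) (g-mono u⊑v)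

  -- spider ls x counts the colourings, with centre coloured x, of the spider
  -- that has one leg of 1 + l edges for each l in ls; span ls is its number of
  -- edges.
  spider : List ℕ → Fin k → ℕ
  spider []       x = 1
  spider (l ∷ ls)   = walks (suc l) · spider ls

  span : List ℕ → ℕ
  span []       = 0
  span (l ∷ ls) = suc l + span ls

  spider-mono : ∀ ls → Monotone (spider ls)
  spider-mono []       _ = ≤-refl
  spider-mono (l ∷ ls) = ·-mono (walks-mono (suc l)) (spider-mono ls)

  spider-pos : ∀ ls {x y} → Adj H x y → 1 ≤ spider ls x
  spider-pos []       x~y = ≤-refl
  spider-pos (l ∷ ls) x~y = *-mono-≤ (walks-pos (suc l) x~y) (spider-pos ls x~y)

  module Chebyshev (c b : ℕ) (r : Fin k → ℕ) where

    private
      W = walkMatrix c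
      f = walks b

      -- The two sides of the rearrangement inequality for the pair `x`, `y`. Their difference is
      -- `W x y` times the product of the increments of `r` and `f` between `x` and `y`.
      diagonal crossed : Fin k → Fin k → ℕ
      diagonal x y = W x y * (r x * f x + r y * f y)
      crossed  x y = W x y * (r x * f y + r y * f x)

      -- Since `W` is symmetric, exchanging `x` and `y` turns the sum with `q` into the sum with
      -- `p`.
      symmetrise : ∀ (p q : Fin k → Fin k → ℕ) → (∀ x y → q x y ≡ p y x) →
        ∑[ x < k ] ∑[ y < k ] (W x y * (p x y + q x y)) ≡ 2 * ∑[ x < k ] ∑[ y < k ] (W x y * p x y)
      symmetrise p q q≡pᵀ = begin
        ∑[ x < k ] ∑[ y < k ] (W x y * (p x y + q x y))
          ≡⟨ ∑-cong (λ x → trans (∑-cong λ y → *-distribˡ-+ (W x y) _ _) (∑-distrib-+ (λ y → W x y * p x y) (λ y → W x y * q x y))) ⟩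
        ∑[ x < k ] (∑[ y < k ] (W x y * p x y) + ∑[ y < k ] (W x y * q x y))
          ≡⟨ ∑-distrib-+ (λ x → ∑[ y < k ] (W x y * p x y)) _ ⟩
        S + ∑[ x < k ] ∑[ y < k ] (W x y * q x y)
          ≡⟨ cong (S +_) (trans (∑-cong λ x → ∑-cong λ y → cong₂ _*_ (walkMatrix-sym c x y) (q≡pᵀ x y)) (∑-comm {k} {k} _)) ⟩
        S + S
          ≡⟨ cong (S +_) (+-identityʳ S) ⟨
        2 * S
          ∎
        where
        open ≡-Reasoning
        S = ∑[ x < k ] ∑[ y < k ] (W x y * p x y)

      factor : ∀ (p : Fin k → Fin k → ℕ) x →
        r x * ∑[ y < k ] (W x y * p x y) ≡ ∑[ y < k ] (W x y * (r x * p x y))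
      factor p x = trans (*-distribˡ-∑ (r x) _) (∑-cong λ y → x∙yz≈y∙xz (r x) (W x y) (p x y))

      sum-crossed : ∑[ x < k ] ∑[ y < k ] crossed x y ≡ 2 * ∑ (r · walks (c + b))
      sum-crossed = trans (symmetrise (λ x y → r x * f y) (λ x y → r y * f x) λ _ _ → refl)
        (cong (2 *_) (∑-cong λ x → trans (sym (factor (λ _ → f) x)) (cong (r x *_) (sym (walks-+ c b x)))))

      walks-row : ∀ x → walks c x ≡ ∑[ y < k ] W x y
      walks-row x = trans (cong (λ n → walks n x) (sym (+-identityʳ c)))
        (trans (walks-+ c 0 x) (∑-cong λ y → *-identityʳ (W x y)))

      sum-diagonal : ∑[ x < k ] ∑[ y < k ] diagonal x y ≡ 2 * ∑ (r · walks c · walks b)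
      sum-diagonal = trans (symmetrise (λ x _ → r x * f x) (λ _ y → r y * f y) λ _ _ → refl)
        (cong (2 *_) (∑-cong λ x → trans (sym (factor (λ x _ → f x) x))
          (cong (r x *_) (trans (sym (*-distribʳ-∑ (f x) (W x))) (cong (_* f x) (sym (walks-row x)))))))

    module _ (nested : Nested H) (r-mono : Monotone r) where

      private
        crossed≤diagonal : ∀ x y → crossed x y ≤ diagonal x y
        crossed≤diagonal x y with nested x y
        ... | inj₁ x⊑y = *-monoʳ-≤ (W x y) (rearrangement (r-mono x⊑y) (walks-mono b x⊑y))
        ... | inj₂ y⊑x = *-monoʳ-≤ (W x y) (subst₂ _≤_ (+-comm (r y * f x) _) (+-comm (r y * f y) _)
                           (rearrangement (r-mono y⊑x) (walks-mono b y⊑x)))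

      -- Nestedness makes every pair comparable, so `r` and `walks b` increase in the same direction
      -- and each crossed term is at most its diagonal term. Both totals count every unordered pair
      -- twice, whence the cancelled factor 2.
      chebyshev : ∑ (r · walks (c + b)) ≤ ∑ (r · walks c · walks b)
      chebyshev = *-cancelˡ-≤ 2 (subst₂ _≤_ sum-crossed sum-diagonal
        (∑-mono-≤ λ x → ∑-mono-≤ (crossed≤diagonal x)))

      chebyshev-< : ∀ {x y} → 1 ≤ walkMatrix c x y → r x < r y → walks b x < walks b y →
        ∑ (r · walks (c + b)) < ∑ (r · walks c · walks b)
      chebyshev-< {x} {y} Wxy r< f< = *-cancelˡ-< 2 _ _ (subst₂ _<_ sum-crossed sum-diagonal
        (∑-mono-< (λ x → ∑-mono-≤ (crossed≤diagonal x)) x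
          (∑-mono-< (crossed≤diagonal x) y
            (*-monoʳ-< (W x y) ⦃ >-nonZero Wxy ⦄ (rearrangement-< r< f<)))))

-- Merging the legs of spiders, and branches of a tree

module Spiders {k : ℕ} (H : Graph k) (nested : Nested H) where

  open Walks H

  -- Chebyshev's inequality splits the first leg off the single path. The weight `r` is general so
  -- that this leg can be moved into it before the induction continues.
  collapse : ∀ ls {r} → Monotone r → ∑ (r · walks (span ls)) ≤ ∑ (r · spider ls)
  collapse []       r-mono = ≤-refl
  collapse (l ∷ ls) {r} r-mono = begin
    ∑ (r · walks (suc l + span ls))              ≤⟨ Chebyshev.chebyshev (suc l) (span ls) r nested r-mono ⟩
    ∑ (r · walks (suc l) · walks (span ls))      ≡⟨ ∑-cong (λ x → *-assoc (r x) _ _) ⟨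
    ∑ ((r · walks (suc l)) · walks (span ls))    ≤⟨ collapse ls (·-mono r-mono (walks-mono (suc l))) ⟩
    ∑ ((r · walks (suc l)) · spider ls)          ≡⟨ ∑-cong (λ x → *-assoc (r x) _ _) ⟩
    ∑ (r · spider (l ∷ ls))                      ∎
    where open ≤-Reasoning

  walks≤spider : ∀ ls → ∑ (walks (span ls)) ≤ ∑ (spider ls)
  walks≤spider ls = subst₂ _≤_ (∑-cong λ x → *-identityˡ _) (∑-cong λ x → *-identityˡ _)
    (collapse ls {λ _ → 1} λ _ → ≤-refl)

  module _ {x y z} (x~y : Adj H x y) (y~z : Adj H y z) (x≁z : ¬ Adj H x z) where

    private
      -- The vertex `z` is in the neighbourhood of `y` but not in that of `x`, which leaves only one
      -- direction of nestedness.
      x⊑y : H ⊢ x ⊑ y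
      x⊑y with nested x y
      ... | inj₁ x⊑y = x⊑y
      ... | inj₂ y⊑x = contradiction (y⊑x z y~z) x≁z

      edge≡1 : ∀ {u v} → Adj H u v → edge u v ≡ 1
      edge≡1 {u} {v} = 𝟙-yes (adj? H u v)

      -- The walks that step to `z` first start at `y` but not at `x`, and there is at least one
      -- because `z` has the neighbour `y`.
      walks-< : ∀ c → walks (suc c) x < walks (suc c) y
      walks-< c = ∑-mono-< (λ t → *-monoˡ-≤ (walks c t) (𝟙-mono (adj? H x t) (adj? H y t) (x⊑y t))) z
        (subst₂ (λ p q → p * walks c z < q * walks c z) (sym (𝟙-no (adj? H x z) x≁z)) (sym (edge≡1 y~z))
          (subst (0 <_) (sym (*-identityˡ _)) (walks-pos c (Graph.~-sym H y~z))))

      walkMatrix-pos : ∀ c → 1 ≤ walkMatrix (suc c) y x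
      walkMatrix-pos zero = begin
        1                        ≡⟨ cong₂ _*_ (edge≡1 (Graph.~-sym H x~y)) (𝟙-yes (x ≟ᶠ x) refl) ⟨
        edge y x * 𝟙 (x ≟ᶠ x)    ≤⟨ term≤∑ (λ t → edge y t * 𝟙 (t ≟ᶠ x)) x ⟩
        walkMatrix 1 y x         ∎
        where open ≤-Reasoning
      walkMatrix-pos (suc c) = begin
        1                                  ≤⟨ walkMatrix-pos c ⟩
        walkMatrix (suc c) y x             ≡⟨ *-identityˡ _ ⟨
        -- `y` carries a loop: it is a neighbour of `x`, and N(x) ⊆ N(y). The extra step is spent on
        -- this loop.
        1 * walkMatrix (suc c) y x         ≡⟨ cong (_* walkMatrix (suc c) y x) (edge≡1 (x⊑y y x~y)) ⟨
        edge y y * walkMatrix (suc c) y x  ≤⟨ term≤∑ (λ t → edge y t * walkMatrix (suc c) t x) y ⟩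
        walkMatrix (suc (suc c)) y x       ∎
        where open ≤-Reasoning

    -- Only the merging of the second and third legs has to be strict. The first leg stays in the
    -- weight `r` and makes it strictly larger at `y` than at `x`; this is where a third leg enters.
    walks<spider : ∀ ls → 3 ≤ length ls → ∑ (walks (span ls)) < ∑ (spider ls)
    walks<spider (_ ∷ [])     (s≤s ())
    walks<spider (_ ∷ _ ∷ []) (s≤s (s≤s ()))
    walks<spider (l₁ ∷ l₂ ∷ l₃ ∷ ls) _ = begin-strict
      ∑ (walks (suc l₁ + (suc l₂ + (suc l₃ + span ls))))
        ≡⟨ cong (λ n → ∑ (walks (suc l₁ + n))) (+-assoc (suc l₂) (suc l₃) (span ls)) ⟨
      -- An entry `l` stands for `1 + l` edges, so the merged leg of `suc l₂ + suc l₃` edges has the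
      -- entry `l₂ + suc l₃`.
      ∑ (walks (span (l₁ ∷ (l₂ + suc l₃) ∷ ls)))
        ≤⟨ walks≤spider (l₁ ∷ (l₂ + suc l₃) ∷ ls) ⟩
      ∑ (walks (suc l₁) · walks (suc l₂ + suc l₃) · spider ls)
        ≡⟨ ∑-cong (λ t → x∙yz≈xz∙y (walks (suc l₁) t) _ _) ⟩
      ∑ (r · walks (suc l₂ + suc l₃))
        <⟨ Chebyshev.chebyshev-< (suc l₂) (suc l₃) r nested r-mono
             (subst (1 ≤_) (walkMatrix-sym (suc l₂) y x) (walkMatrix-pos l₂)) r-< (walks-< l₃) ⟩
      ∑ (r · walks (suc l₂) · walks (suc l₃))
        ≡⟨ ∑-cong (λ t → reorder (walks (suc l₁) t) (walks (suc l₂) t) (walks (suc l₃) t) (spider ls t)) ⟩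
      ∑ (spider (l₁ ∷ l₂ ∷ l₃ ∷ ls))
        ∎
      where
      open ≤-Reasoning
      open +-*-Solver
      r = walks (suc l₁) · spider ls

      r-mono : Monotone r
      r-mono = ·-mono (walks-mono (suc l₁)) (spider-mono ls)

      r-< : r x < r y
      r-< = <-≤-trans (*-monoˡ-< (spider ls x) ⦃ >-nonZero (spider-pos ls x~y) ⦄ (walks-< l₁))
                      (*-monoʳ-≤ (walks (suc l₁) y) (spider-mono ls x⊑y))

      reorder : ∀ a b c d → a * d * (b * c) ≡ a * (b * (c * d))
      reorder = solve 4 (λ a b c d → a :* d :* (b :* c) := a :* (b :* (c :* d))) refl

  -- The part of the tree already pruned away below a vertex, that vertex
  -- included: weight x is its number of colourings with the vertex coloured x.
  record Branch : Set where
    field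
      weight    : Fin k → ℕ
      legs      : List ℕ
      dominates : ∀ {r} → Monotone r → ∑ (r · spider legs) ≤ ∑ (r · weight)

    size : ℕ
    size = suc (span legs)

  open Branch public

  trivial : Branch
  trivial = record { weight = λ _ → 1 ; legs = [] ; dominates = λ _ → ≤-refl }

  -- The root of `s` is joined by an edge to the root of `t`. Self-adjointness moves the sum to the
  -- root of `s`, where its legs are merged into one path and then compared with its weight. With
  -- the joining edge, that path is one new leg at the root of `t`.
  absorb : Branch → Branch → Branch
  absorb s t = record
    { weight = A (weight s) · weight t
    ; legs = span (legs s) ∷ legs t
    ; dominates = λ {r} r-mono → begin
        ∑ (r · A (walks (span (legs s))) · spider (legs t))       ≡⟨ ∑-cong (λ x → x∙yz≈xz∙y (r x) _ _) ⟩
        ∑ ((r · spider (legs t)) · A (walks (span (legs s))))     ≡⟨ A-adjoint (r · spider (legs t)) _ ⟨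
        ∑ (A (r · spider (legs t)) · walks (span (legs s)))       ≤⟨ collapse (legs s) (A-mono (r · spider (legs t))) ⟩
        ∑ (A (r · spider (legs t)) · spider (legs s))             ≤⟨ dominates s (A-mono (r · spider (legs t))) ⟩
        ∑ (A (r · spider (legs t)) · weight s)                    ≡⟨ A-adjoint (r · spider (legs t)) _ ⟩
        ∑ ((r · spider (legs t)) · A (weight s))                  ≡⟨ ∑-cong (λ x → xy∙z≈xz∙y (r x) _ _) ⟩
        ∑ ((r · A (weight s)) · spider (legs t))                  ≤⟨ dominates t (·-mono r-mono (A-mono (weight s))) ⟩
        ∑ ((r · A (weight s)) · weight t)                         ≡⟨ ∑-cong (λ x → *-assoc (r x) _ _) ⟩
        ∑ (r · A (weight s) · weight t)                           ∎
    }
    where open ≤-Reasoning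

-- Colourings weighted at the vertices

delete : ∀ {m} → Graph (suc m) → Fin (suc m) → Graph m
delete G ℓ = record
  { _~_   = λ u v → Adj G (punchIn ℓ u) (punchIn ℓ v)
  ; ~-sym = Graph.~-sym G
  ; _~?_  = λ u v → adj? G (punchIn ℓ u) (punchIn ℓ v)
  }

-- The neighbour is indexed in `delete G ℓ`, which makes it distinct from `ℓ` and lets pruning
-- update its data directly.
record Leaf {m} (G : Graph (suc m)) (ℓ : Fin (suc m)) : Set where
  field
    neighbour : Fin m
    attached  : Adj G ℓ (punchIn ℓ neighbour)
    unique    : ∀ v → Adj G ℓ v → v ≡ punchIn ℓ neighbour

  ≁self : ¬ Adj G ℓ ℓ
  ≁self ℓ~ℓ = punchInᵢ≢i ℓ neighbour (sym (unique ℓ ℓ~ℓ))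

data PunchView {m} (ℓ : Fin (suc m)) : Fin (suc m) → Set where
  here  : PunchView ℓ ℓ
  there : ∀ v → PunchView ℓ (punchIn ℓ v)

punchView : ∀ {m} (ℓ v : Fin (suc m)) → PunchView ℓ v
punchView ℓ v with ℓ ≟ᶠ v
... | yes refl = here
... | no ℓ≢v   = subst (PunchView ℓ) (punchIn-punchOut ℓ≢v) (there (punchOut ℓ≢v))

module Colourings {k : ℕ} (H : Graph k) where

  open Walks H

  IsColoring-cong : ∀ {m} (G : Graph m) {f g : Fin m → Fin k} → f ≗ g → IsColoring G H f → IsColoring G H g
  IsColoring-cong G f≗g col u v u~v = subst₂ (Adj H) (f≗g u) (f≗g v) (col u v u~v)

  coloring : ∀ {m} → Graph m → (Fin m → Fin k) → ℕ
  coloring G f = 𝟙 (isColoring? G H f)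

  coloring-extensional : ∀ {m} (G : Graph m) → Extensional (coloring G)
  coloring-extensional G f≗g = 𝟙-cong (isColoring? G H _) (isColoring? G H _)
    (IsColoring-cong G f≗g) (IsColoring-cong G (sym ∘ f≗g))

  hom≡sumMaps : ∀ {m} (G : Graph m) → hom G H ≡ sumMaps m (coloring G)
  hom≡sumMaps {m} G = trans (length-filter-tabulate (isColoring? G H ∘ finToFun) (λ i → i))
    (∑-finToFun m (coloring G) (coloring-extensional G))

  hom-cong : ∀ {m} (G G′ : Graph m) → (∀ f → IsColoring G H f → IsColoring G′ H f) →
    (∀ f → IsColoring G′ H f → IsColoring G H f) → hom G H ≡ hom G′ H
  hom-cong {m} G G′ G⇒G′ G′⇒G = begin
    hom G H                   ≡⟨ hom≡sumMaps G ⟩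
    sumMaps m (coloring G)    ≡⟨ sumMaps-cong m (λ f → 𝟙-cong (isColoring? G H f) (isColoring? G′ H f) (G⇒G′ f) (G′⇒G f)) ⟩
    sumMaps m (coloring G′)   ≡⟨ hom≡sumMaps G′ ⟨
    hom G′ H                  ∎
    where open ≡-Reasoning

  weighted : ∀ {m} → Graph m → (Fin m → Fin k → ℕ) → (Fin m → Fin k) → ℕ
  weighted G w f = coloring G f * ∏ (λ v → w v (f v))

  -- The partition function of `H`-colourings with a vertex weight `w v` at each `v`; the weights
  -- record what has already been pruned away.
  partition : ∀ {m} → Graph m → (Fin m → Fin k → ℕ) → ℕ
  partition {m} G w = sumMaps m (weighted G w)

  hom≡partition : ∀ {m} (G : Graph m) → hom G H ≡ partition G (λ _ _ → 1)
  hom≡partition {m} G = trans (hom≡sumMaps G)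
    (sumMaps-cong m λ f → sym (trans (cong (coloring G f *_) (∏-one m)) (*-identityʳ _)))
    where
    ∏-one : ∀ m → ∏ {m} (λ _ → 1) ≡ 1
    ∏-one zero    = refl
    ∏-one (suc m) = trans (*-identityˡ _) (∏-one m)

  partition-singleton : ∀ (G : Graph 1) w → Loopless G → partition G w ≡ ∑ (w zero)
  partition-singleton G w loopless = ∑-cong λ y →
    trans (cong₂ _*_ (𝟙-yes (isColoring? G H _) λ { zero zero u~u → contradiction u~u (loopless zero) })
                     (*-identityʳ (w zero y)))
          (*-identityˡ _)

  -- Summing over the colour of the leaf first leaves the factor `A (w ℓ)` at its neighbour. The new
  -- weights are constrained only through their product, so each caller can present them in its own
  -- form.
  partition-prune : ∀ {m} (G : Graph (suc m)) {ℓ} (leaf : Leaf G ℓ) (let open Leaf leaf)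
    (w : Fin (suc m) → Fin k → ℕ) (w′ : Fin m → Fin k → ℕ) →
    (∀ g → ∏ (λ v → w′ v (g v)) ≡ A (w ℓ) (g neighbour) * ∏ (λ v → w (punchIn ℓ v) (g v))) →
    partition G w ≡ partition (delete G ℓ) w′
  partition-prune {m} G {ℓ} leaf w w′ ∏w′ = begin
    sumMaps (suc m) (weighted G w)
      ≡⟨ sumMaps-insertAt ℓ (weighted G w) (λ f≗g → cong₂ _*_ (coloring-extensional G f≗g) (∏-cong λ v → cong (w v) (f≗g v))) ⟩
    sumMaps m (λ g → ∑[ y < k ] weighted G w (insertAt g ℓ y))
      ≡⟨ sumMaps-cong m prune ⟩
    sumMaps m (weighted (delete G ℓ) w′)
      ∎
    where
    open ≡-Reasoning
    open Leaf leaf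

    restrict : ∀ g y → IsColoring G H (insertAt g ℓ y) → IsColoring (delete G ℓ) H g × Adj H (g neighbour) y
    restrict g y col =
      (λ u v u~v → subst₂ (Adj H) (insertAt-punchIn g ℓ y u) (insertAt-punchIn g ℓ y v) (col _ _ u~v)) ,
      subst₂ (Adj H) (insertAt-punchIn g ℓ y neighbour) (insertAt-lookup g ℓ y) (col _ _ (Graph.~-sym G attached))

    extend : ∀ g y → IsColoring (delete G ℓ) H g × Adj H (g neighbour) y → IsColoring G H (insertAt g ℓ y)
    extend g y (col , y~) u v u~v with punchView ℓ u | punchView ℓ v
    ... | here    | here    = contradiction u~v ≁self
    ... | here    | there v rewrite insertAt-lookup g ℓ y | unique _ u~v | insertAt-punchIn g ℓ y neighbour = Graph.~-sym H y~
    ... | there u | here    rewrite insertAt-lookup g ℓ y | unique _ (Graph.~-sym G u~v) | insertAt-punchIn g ℓ y neighbour = y~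
    ... | there u | there v rewrite insertAt-punchIn g ℓ y u | insertAt-punchIn g ℓ y v = col u v u~v

    coloring-insertAt : ∀ g y → coloring G (insertAt g ℓ y) ≡ coloring (delete G ℓ) g * edge (g neighbour) y
    coloring-insertAt g y =
      trans (𝟙-cong (isColoring? G H _) (isColoring? (delete G ℓ) H g ×-dec adj? H (g neighbour) y) (restrict g y) (extend g y))
            (𝟙-× (isColoring? (delete G ℓ) H g) (adj? H (g neighbour) y))

    ∏-insertAt : ∀ g y → ∏ (λ v → w v (insertAt g ℓ y v)) ≡ w ℓ y * ∏ (λ v → w (punchIn ℓ v) (g v))
    ∏-insertAt g y = trans (∏-remove {i = ℓ} λ v → w v (insertAt g ℓ y v))
      (cong₂ _*_ (cong (w ℓ) (insertAt-lookup g ℓ y)) (∏-cong λ v → cong (w (punchIn ℓ v)) (insertAt-punchIn g ℓ y v)))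

    regroup : ∀ c e a p → c * e * (a * p) ≡ c * (e * a * p)
    regroup c e a p = trans (*-assoc c e _) (cong (c *_) (sym (*-assoc e a p)))

    prune : ∀ g → ∑[ y < k ] weighted G w (insertAt g ℓ y) ≡ weighted (delete G ℓ) w′ g
    prune g = begin
      ∑[ y < k ] weighted G w (insertAt g ℓ y)
        ≡⟨ ∑-cong (λ y → trans (cong₂ _*_ (coloring-insertAt g y) (∏-insertAt g y)) (regroup C (edge (g neighbour) y) (w ℓ y) P)) ⟩
      ∑[ y < k ] (C * (edge (g neighbour) y * w ℓ y * P))
        ≡⟨ *-distribˡ-∑ C _ ⟨
      C * ∑[ y < k ] (edge (g neighbour) y * w ℓ y * P)
        ≡⟨ cong (C *_) (*-distribʳ-∑ P _) ⟨
      C * (A (w ℓ) (g neighbour) * P)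
        ≡⟨ cong (C *_) (∏w′ g) ⟨
      weighted (delete G ℓ) w′ g
        ∎
      where
      C = coloring (delete G ℓ) g
      P = ∏ (λ v → w (punchIn ℓ v) (g v))

-- Trails and leaves in trees

-- Only the values of vertex at 0, …, len matter.
record Trail {n} (G : Graph n) : Set where
  field
    len      : ℕ
    vertex   : ℕ → Fin n
    distinct : ∀ {i j} → i ≤ len → j ≤ len → vertex i ≡ vertex j → i ≡ j
    step     : ∀ {i} → i < len → Adj G (vertex i) (vertex (suc i))

module _ {n} {G : Graph n} where

  open Trail

  infix 4 _∈ₜ_ _∈ₜ?_
  _∈ₜ_ : Fin n → Trail G → Set
  v ∈ₜ p = ∃[ i ] i ≤ len p × vertex p i ≡ v

  _∈ₜ?_ : ∀ v (p : Trail G) → Dec (v ∈ₜ p)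
  v ∈ₜ? p = map′ (λ (i , eq) → toℕ i , s≤s⁻¹ (toℕ<n i) , eq)
                 (λ (i , i≤ , eq) → fromℕ< (s≤s i≤) , trans (cong (vertex p) (toℕ-fromℕ< (s≤s i≤))) eq)
                 (any? λ i → vertex p (toℕ i) ≟ᶠ v)

  len<n : ∀ (p : Trail G) → len p < n
  len<n p = injective⇒≤ {suc (len p)} {f = vertex p ∘ toℕ}
    λ {i} {j} eq → toℕ-injective (distinct p (s≤s⁻¹ (toℕ<n i)) (s≤s⁻¹ (toℕ<n j)) eq)

  single : Fin n → Trail G
  single v = record { len = 0 ; vertex = λ _ → v ; distinct = λ { z≤n z≤n _ → refl } ; step = λ () }

  cons : ∀ p v → Adj G v (vertex p 0) → ¬ v ∈ₜ p → Trail G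
  cons p v v~p v∉p = record { len = suc (len p) ; vertex = vertex′ ; distinct = distinct′ _ _ ; step = step′ _ }
    where
    vertex′ : ℕ → Fin n
    vertex′ zero    = v
    vertex′ (suc i) = vertex p i

    distinct′ : ∀ i j → i ≤ suc (len p) → j ≤ suc (len p) → vertex′ i ≡ vertex′ j → i ≡ j
    distinct′ zero    zero    _        _        _  = refl
    distinct′ zero    (suc j) _        (s≤s j≤) eq = contradiction (j , j≤ , sym eq) v∉p
    distinct′ (suc i) zero    (s≤s i≤) _        eq = contradiction (i , i≤ , eq) v∉p
    distinct′ (suc i) (suc j) (s≤s i≤) (s≤s j≤) eq = cong suc (distinct p i≤ j≤ eq)

    step′ : ∀ i → i < suc (len p) → Adj G (vertex′ i) (vertex′ (suc i))
    step′ zero    _        = v~p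
    step′ (suc i) (s≤s i<) = step p i<

  reverse : Trail G → Trail G
  reverse p = record
    { len      = len p
    ; vertex   = λ i → vertex p (len p ∸ i)
    ; distinct = λ {i} {j} i≤ j≤ eq → ∸-cancelˡ-≡ i≤ j≤ (distinct p (m∸n≤m _ i) (m∸n≤m _ j) eq)
    ; step     = λ {i} i< → Graph.~-sym G (subst (λ j → Adj G (vertex p (len p ∸ suc i)) (vertex p j))
                   (sym (+-∸-assoc 1 i<)) (step p (∸-monoʳ-< z<s i<)))
    }

  ∈-reverse : ∀ p {v} → v ∈ₜ p → v ∈ₜ reverse p
  ∈-reverse p (i , i≤ , eq) = len p ∸ i , m∸n≤m _ i , trans (cong (vertex p) (m∸[m∸n]≡n i≤)) eq

  Stuck : Trail G → Set
  Stuck p = ∀ v → Adj G (vertex p 0) v → v ∈ₜ p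

  record Extends (p q : Trail G) : Set where
    field
      same-end : vertex q (len q) ≡ vertex p (len p)
      covers   : ∀ v → v ∈ₜ p → v ∈ₜ q

  -- Vertices are prepended greedily, so the last vertex stays fixed. The fuel `n` is enough because
  -- a trail has fewer than `n` edges.
  maximise : ∀ (p : Trail G) → ∃[ q ] Stuck q × Extends p q
  maximise p = go n p (m≤m+n n _)
    where
    go : ∀ fuel (p : Trail G) → n ≤ fuel + len p → ∃[ q ] Stuck q × Extends p q
    go zero       p n≤ = contradiction n≤ (<⇒≱ (len<n p))
    go (suc fuel) p n≤ with any? (λ v → adj? G (vertex p 0) v ×-dec ¬? (v ∈ₜ? p))
    ... | yes (v , p~v , v∉p) =
      let q , stuck , extends = go fuel (cons p v (Graph.~-sym G p~v) v∉p) (subst (n ≤_) (sym (+-suc fuel _)) n≤)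
          open Extends extends
      in q , stuck , record
        { same-end = same-end
        ; covers   = λ { u (i , i≤ , eq) → covers u (suc i , s≤s i≤ , eq) }
        }
    ... | no none = p , stuck , record { same-end = refl ; covers = λ _ v∈p → v∈p }
      where
      stuck : Stuck p
      stuck v p~v with v ∈ₜ? p
      ... | yes v∈p = v∈p
      ... | no  v∉p = contradiction (v , p~v , v∉p) none

  -- The stretch of the trail between the ends of the chord has `3 + d` vertices, and the chord
  -- closes it.
  chord⇒cycle : ∀ (p : Trail G) i d → i + (2 + d) ≤ len p → Adj G (vertex p (i + (2 + d))) (vertex p i) → Cycle G
  chord⇒cycle p i d i+2+d≤ chord = record
    { k        = d
    ; vertex   = λ t → vertex p (i + toℕ t)
    ; distinct = λ {s} {t} eq → toℕ-injective (+-cancelˡ-≡ i _ _ (distinct p (bound s) (bound t) eq))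
    ; step     = λ t → subst₂ (λ a b → Adj G (vertex p a) (vertex p b))
                   (cong (i +_) (sym (toℕ-inject₁ t))) (sym (+-suc i (toℕ t)))
                   (step p (≤-trans (≤-reflexive (sym (+-suc i (toℕ t)))) (bound (suc t))))
    ; close    = subst₂ (λ a b → Adj G (vertex p a) (vertex p b))
                   (cong (i +_) (sym (toℕ-fromℕ (2 + d)))) (sym (+-identityʳ i)) chord
    }
    where
    bound : ∀ (t : Fin (3 + d)) → i + toℕ t ≤ len p
    bound t = ≤-trans (+-monoʳ-≤ i (s≤s⁻¹ (toℕ<n t))) i+2+d≤

module Trees {n} (T : Tree n) where

  open Tree T
  open Trail

  chordless : ∀ (p : Trail graph) {i j} → j ≤ len p → i < j → Adj graph (vertex p i) (vertex p j) → j ≡ suc i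
  chordless p {i} j≤ i<j i~j with m≤n⇒∃[o]m+o≡n i<j
  ... | zero  , refl = cong suc (+-identityʳ i)
  ... | suc d , refl = contradiction
    (chord⇒cycle p i d (subst (_≤ len p) eq j≤)
      (Graph.~-sym graph (subst (λ a → Adj graph (vertex p i) (vertex p a)) eq i~j)))
    acyclic
    where
    eq : suc i + suc d ≡ i + (2 + d)
    eq = sym (+-suc i (suc d))

  -- Acyclicity forbids chords, so a trail in a tree is an induced path.
  consecutive : ∀ (p : Trail graph) {i j} → i ≤ len p → j ≤ len p → Adj graph (vertex p i) (vertex p j) →
    j ≡ suc i ⊎ i ≡ suc j
  consecutive p {i} {j} i≤ j≤ i~j with <-cmp i j
  ... | tri< i<j _ _  = inj₁ (chordless p j≤ i<j i~j)
  ... | tri≈ _ refl _ = contradiction i~j (loopless _)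
  ... | tri> _ _ j<i  = inj₂ (chordless p i≤ j<i (Graph.~-sym graph i~j))

  stuck⇒unique : ∀ p → Stuck p → ∀ v → Adj graph (vertex p 0) v → 1 ≤ len p × v ≡ vertex p 1
  stuck⇒unique p stuck v p~v with stuck v p~v
  ... | j , j≤ , refl with consecutive p z≤n j≤ p~v
  ... | inj₁ refl = j≤ , refl

has-neighbour : ∀ {m} (T : Tree (suc (suc m))) v → ∃[ u ] Adj (Tree.graph T) v u
has-neighbour T v with Tree.connected T v (punchIn v zero) | punchInᵢ≢i v zero
... | path | v≢ = first path v≢
  where
  first : ∀ {w} → Star (Adj (Tree.graph T)) v w → w ≢ v → ∃[ u ] Adj (Tree.graph T) v u
  first ε         w≢v = contradiction refl w≢v
  first (v~u ◅ _) w≢v = _ , v~u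

-- A trail grown from `v` keeps `v` as its last vertex, and its first vertex, once stuck, has only
-- the next one as neighbour. Avoiding `v` lets the chosen centre survive all the pruning.
exists-leaf : ∀ {m} (T : Tree (suc (suc m))) v → ∃[ ℓ ] ℓ ≢ v × Leaf (Tree.graph T) ℓ
exists-leaf T v with maximise (single {G = Tree.graph T} v)
... | p , stuck , extends with has-neighbour T (Trail.vertex p 0)
... | u , ℓ~u with Trees.stuck⇒unique T p stuck u ℓ~u
... | 1≤len , refl = vertex 0 , ℓ≢v , record
  { neighbour = punchOut ℓ≢u
  ; attached  = subst (Adj (Tree.graph T) (vertex 0)) (sym (punchIn-punchOut ℓ≢u)) ℓ~u
  ; unique    = λ w ℓ~w → trans (proj₂ (Trees.stuck⇒unique T p stuck w ℓ~w)) (sym (punchIn-punchOut ℓ≢u))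
  }
  where
  open Trail p
  ℓ≢u : vertex 0 ≢ vertex 1
  ℓ≢u eq = 0≢1+n (distinct z≤n 1≤len eq)

  ℓ≢v : vertex 0 ≢ v
  ℓ≢v eq = <⇒≢ 1≤len (distinct z≤n ≤-refl (trans eq (sym (Extends.same-end extends))))

pruneTree : ∀ {m} (T : Tree (suc m)) {ℓ} → Leaf (Tree.graph T) ℓ → Tree m
pruneTree {m} T {ℓ} leaf = record
  { graph     = delete graph ℓ
  ; loopless  = λ v → loopless (punchIn ℓ v)
  ; connected = λ u v → shortcut (connected (punchIn ℓ u) (punchIn ℓ v)) refl refl
  ; acyclic   = λ c → acyclic record
      { k        = Cycle.k c
      ; vertex   = punchIn ℓ ∘ Cycle.vertex c
      ; distinct = λ eq → Cycle.distinct c (punchIn-injective ℓ _ _ eq)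
      ; step     = Cycle.step c
      ; close    = Cycle.close c
      }
  }
  where
  open Tree T
  open Leaf leaf

  -- A walk through the leaf `ℓ` enters and leaves it by the same neighbour, so these two steps can
  -- be cut out.
  shortcut : ∀ {x y u v} → Star (Adj graph) x y → x ≡ punchIn ℓ u → y ≡ punchIn ℓ v →
    Star (Adj (delete graph ℓ)) u v
  shortcut {u = u} {v} ε refl eq with refl ← punchIn-injective ℓ u v eq = ε
  shortcut (_◅_ {j = z} x~z path) refl eq with punchView ℓ z
  shortcut (x~z ◅ path)          refl eq   | there z = x~z ◅ shortcut path refl eq
  shortcut (x~z ◅ ε)             refl eq   | here    = contradiction (sym eq) (punchInᵢ≢i ℓ _)
  shortcut (x~z ◅ ℓ~z′ ◅ path)   refl eq   | here    =
    shortcut path (trans (unique _ ℓ~z′) (sym (unique _ (Graph.~-sym graph x~z)))) eq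

-- Colourings of trees and paths

degree : ∀ {m} → Graph m → Fin m → ℕ
degree {m} G v = ∑[ u < m ] 𝟙 (adj? G v u)

module SpiderBound {k : ℕ} (H : Graph k) (nested : Nested H) where

  open Walks H
  open Spiders H nested
  open Colourings H

  -- Leaves other than `v` are pruned, each branch being absorbed by its neighbour's, until only `v`
  -- is left. The total size is invariant, and so is the number of legs at `v` plus its degree: a
  -- leg is gained exactly when a neighbour of `v` is pruned.
  partition≡branch : ∀ {m} (T : Tree (suc m)) v (b : Fin (suc m) → Branch) →
    ∃[ s ] size s ≡ ∑ (size ∘ b)
         × length (legs s) ≡ length (legs (b v)) + degree (Tree.graph T) v
         × partition (Tree.graph T) (weight ∘ b) ≡ ∑ (weight s)
  partition≡branch {zero} T zero b = b zero , sym (∑-one (size ∘ b)) ,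
    sym (trans (cong (length (legs (b zero)) +_)
                 (trans (∑-one λ u → 𝟙 (adj? graph zero u)) (𝟙-no (adj? graph zero zero) (loopless zero))))
               (+-identityʳ _)) ,
    partition-singleton graph (weight ∘ b) loopless
    where open Tree T
  partition≡branch {suc m} T v b with exists-leaf T v
  ... | ℓ , ℓ≢v , leaf with punchView ℓ v
  ... | here     = contradiction refl ℓ≢v
  ... | there v′ = s , trans size-s size-b′ , trans length-s length-b′ , trans partition-b′ partition-s
    where
    open Tree T
    open Leaf leaf

    b′ : Fin (suc m) → Branch
    b′ = updateAt (removeAt b ℓ) neighbour (absorb (b ℓ))

    IH = partition≡branch (pruneTree T leaf) v′ b′
    s = proj₁ IH
    size-s = proj₁ (proj₂ IH)
    length-s = proj₁ (proj₂ (proj₂ IH))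
    partition-s = proj₂ (proj₂ (proj₂ IH))

    size-b′ : ∑ (size ∘ b′) ≡ ∑ (size ∘ b)
    size-b′ = trans (∑-updateAt size (removeAt b ℓ) neighbour (absorb (b ℓ)) (cong suc (sym (+-suc _ _))))
                    (sym (∑-remove ℓ (size ∘ b)))

    v~ℓ? = adj? graph (punchIn ℓ v′) ℓ

    legs-b′ : length (legs (b′ v′)) ≡ length (legs (b (punchIn ℓ v′))) + 𝟙 v~ℓ?
    legs-b′ with v′ ≟ᶠ neighbour
    ... | yes refl = trans (cong (length ∘ legs) (updateAt-updates v′ (removeAt b ℓ)))
                           (trans (+-comm 1 _) (cong (length (legs (b (punchIn ℓ v′))) +_)
                             (sym (𝟙-yes v~ℓ? (Graph.~-sym graph attached)))))
    ... | no v′≢   = trans (cong (length ∘ legs) (updateAt-minimal v′ neighbour (removeAt b ℓ) v′≢))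
                           (trans (sym (+-identityʳ _)) (cong (length (legs (b (punchIn ℓ v′))) +_)
                             (sym (𝟙-no v~ℓ? λ v~ℓ → v′≢ (punchIn-injective ℓ _ _ (unique _ (Graph.~-sym graph v~ℓ)))))))

    length-b′ : length (legs (b′ v′)) + degree (delete graph ℓ) v′ ≡ length (legs (b (punchIn ℓ v′))) + degree graph (punchIn ℓ v′)
    length-b′ = trans (cong (_+ degree (delete graph ℓ) v′) legs-b′)
      (trans (+-assoc (length (legs (b (punchIn ℓ v′)))) _ _)
        (cong (length (legs (b (punchIn ℓ v′))) +_) (sym (∑-remove ℓ λ u → 𝟙 (adj? graph (punchIn ℓ v′) u)))))

    partition-b′ : partition graph (weight ∘ b) ≡ partition (delete graph ℓ) (weight ∘ b′)
    partition-b′ = partition-prune graph leaf (weight ∘ b) (weight ∘ b′) λ g →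
      sum-updateAt *-1-commutativeMonoid (λ i t → weight t (g i)) (removeAt b ℓ) neighbour (absorb (b ℓ))
        {A (weight (b ℓ)) (g neighbour)} refl

  spider-bound : ∀ {m} (T : Tree (suc m)) v →
    ∃[ ls ] span ls ≡ m × length ls ≡ degree (Tree.graph T) v × ∑ (spider ls) ≤ hom (Tree.graph T) H
  spider-bound {m} T v with partition≡branch T v (λ _ → trivial)
  ... | s , size-s , length-s , partition-s = legs s , suc-injective (trans size-s (∑-1 (suc m))) , length-s , (begin
      ∑ (spider (legs s))               ≡⟨ ∑-cong (λ x → *-identityˡ _) ⟨
      ∑ ((λ _ → 1) · spider (legs s))   ≤⟨ dominates s {λ _ → 1} (λ _ → ≤-refl) ⟩
      ∑ ((λ _ → 1) · weight s)          ≡⟨ ∑-cong (λ x → *-identityˡ _) ⟩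
      ∑ (weight s)                      ≡⟨ partition-s ⟨
      partition (Tree.graph T) (λ _ _ → 1) ≡⟨ hom≡partition (Tree.graph T) ⟨
      hom (Tree.graph T) H              ∎)
    where
    open ≤-Reasoning

    ∑-1 : ∀ n → ∑ {n} (λ _ → 1) ≡ n
    ∑-1 zero    = ∑-empty _
    ∑-1 (suc n) = trans (∑-suc {n} λ _ → 1) (cong suc (∑-1 n))

path-leaf : ∀ m → Leaf (path (suc (suc m))) zero
path-leaf m = record
  { neighbour = zero
  ; attached  = inj₁ refl
  ; unique    = λ { v (inj₁ eq) → toℕ-injective eq }
  }

module PathColourings {k : ℕ} (H : Graph k) where

  open Walks H
  open Colourings H

  partition-cong : ∀ {m} (G G′ : Graph m) w → (∀ u v → Adj G u v → Adj G′ u v) → (∀ u v → Adj G′ u v → Adj G u v) →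
    partition G w ≡ partition G′ w
  partition-cong {m} G G′ w G⊆G′ G′⊆G = sumMaps-cong m λ f →
    cong (_* ∏ (λ v → w v (f v))) (𝟙-cong (isColoring? G H f) (isColoring? G′ H f)
      (λ col u v u~v → col u v (G′⊆G u v u~v)) (λ col u v u~v → col u v (G⊆G′ u v u~v)))

  -- Pruning the end `zero` passes the weight `A w` to the next vertex; self-adjointness then shifts
  -- the operator from the weight to the walk count.
  partition-path : ∀ m (w : Fin k → ℕ) → partition (path (suc m)) (w Vector.∷ λ _ _ → 1) ≡ ∑ (w · walks m)
  partition-path zero    w = trans (partition-singleton (path 1) (w Vector.∷ λ _ _ → 1) (λ { zero (inj₁ ()) ; zero (inj₂ ()) }))
    (∑-cong λ x → sym (*-identityʳ (w x)))
  partition-path (suc m) w = begin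
    partition (path (suc (suc m))) (w Vector.∷ λ _ _ → 1)
      ≡⟨ partition-prune (path (suc (suc m))) (path-leaf m) (w Vector.∷ λ _ _ → 1) (A w Vector.∷ λ _ _ → 1)
           (λ g → cong (A w (g zero) *_) (sym (*-identityˡ _))) ⟩
    partition (delete (path (suc (suc m))) zero) (A w Vector.∷ λ _ _ → 1)
      ≡⟨ partition-cong (delete (path (suc (suc m))) zero) (path (suc m)) (A w Vector.∷ λ _ _ → 1)
           (λ u v → Sum.map suc-injective suc-injective) (λ u v → Sum.map (cong suc) (cong suc)) ⟩
    partition (path (suc m)) (A w Vector.∷ λ _ _ → 1)
      ≡⟨ partition-path m (A w) ⟩
    ∑ (A w · walks m)
      ≡⟨ A-adjoint w (walks m) ⟩
    ∑ (w · walks (suc m))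
      ∎
    where open ≡-Reasoning

  hom-path : ∀ m → hom (path (suc m)) H ≡ ∑ (walks m)
  hom-path m = trans (hom≡partition (path (suc m)))
    (trans (sumMaps-cong (suc m) {weighted (path (suc m)) λ _ _ → 1} λ f → refl)
      (trans (partition-path m λ _ → 1) (∑-cong λ x → *-identityˡ _)))

-- Trees without a branching vertex are paths

degree≥3 : ∀ {m} (G : Graph m) {v a b c} → Adj G v a → Adj G v b → Adj G v c → a ≢ b → a ≢ c → b ≢ c →
  3 ≤ degree G v
degree≥3 {m} G {v} {a} {b} {c} v~a v~b v~c a≢b a≢c b≢c = begin
  1 + (1 + 1)                                ≡⟨ cong₂ _+_ (∑-𝟙 a) (cong₂ _+_ (∑-𝟙 b) (∑-𝟙 c)) ⟨
  ∑ (is a) + (∑ (is b) + ∑ (is c))           ≡⟨ cong (∑ (is a) +_) (∑-distrib-+ (is b) (is c)) ⟨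
  ∑ (is a) + ∑[ u < m ] (is b u + is c u)    ≡⟨ ∑-distrib-+ (is a) _ ⟨
  ∑[ u < m ] (is a u + (is b u + is c u))    ≤⟨ ∑-mono-≤ bound ⟩
  degree G v                                 ∎
  where
  open ≤-Reasoning
  is : Fin m → Fin m → ℕ
  is w u = 𝟙 (w ≟ᶠ u)

  ∑-𝟙 : ∀ w → ∑ (is w) ≡ 1
  ∑-𝟙 w = trans (∑-cong λ u → sym (*-identityʳ (is w u))) (∑-δ w λ _ → 1)

  bound : ∀ u → is a u + (is b u + is c u) ≤ 𝟙 (adj? G v u)
  bound u with a ≟ᶠ u | b ≟ᶠ u | c ≟ᶠ u
  ... | yes refl | yes refl | _        = contradiction refl a≢b
  ... | yes refl | no _     | yes refl = contradiction refl a≢c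
  ... | yes refl | no _     | no _     = ≤-reflexive (sym (𝟙-yes (adj? G v u) v~a))
  ... | no _     | yes refl | yes refl = contradiction refl b≢c
  ... | no _     | yes refl | no _     = ≤-reflexive (sym (𝟙-yes (adj? G v u) v~b))
  ... | no _     | no _     | yes refl = ≤-reflexive (sym (𝟙-yes (adj? G v u) v~c))
  ... | no _     | no _     | no _     = z≤n

module _ {n} (T : Tree n) where

  open Tree T
  open Trail

  -- Positions on the trail number the vertices, and the absence of chords rules out any further
  -- edge.
  hamiltonian⇒path : ∀ (p : Trail graph) → (∀ v → v ∈ₜ p) → graph ≅ path n
  hamiltonian⇒path p all∈p = record
    { bijection = mk↔ₛ′ to (vertex p ∘ toℕ)
        (λ i → toℕ-injective (trans (toℕ-to _) (distinct p (index≤ _) (toℕ≤ i) (at-index _))))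
        (λ v → trans (cong (vertex p) (toℕ-to v)) (at-index v))
    ; adjacency = λ u v → mk⇔ (adjacent⇒ u v) (adjacent⇐ u v)
    }
    where
    index : Fin n → ℕ
    index v = proj₁ (all∈p v)

    index≤ : ∀ v → index v ≤ len p
    index≤ v = proj₁ (proj₂ (all∈p v))

    at-index : ∀ v → vertex p (index v) ≡ v
    at-index v = proj₂ (proj₂ (all∈p v))

    index< : ∀ v → index v < n
    index< v = ≤-<-trans (index≤ v) (len<n p)

    n≤1+len : n ≤ suc (len p)
    n≤1+len = injective⇒≤ {f = λ v → fromℕ< (s≤s (index≤ v))} λ {u} {v} eq →
      trans (sym (at-index u)) (trans (cong (vertex p) (fromℕ<-injective _ _ (s≤s (index≤ u)) (s≤s (index≤ v)) eq)) (at-index v))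

    toℕ≤ : ∀ (i : Fin n) → toℕ i ≤ len p
    toℕ≤ i = s≤s⁻¹ (≤-trans (toℕ<n i) n≤1+len)

    to : Fin n → Fin n
    to v = fromℕ< (index< v)

    toℕ-to : ∀ v → toℕ (to v) ≡ index v
    toℕ-to v = toℕ-fromℕ< (index< v)

    adjacent⇒ : ∀ u v → Adj graph u v → Adj (path n) (to u) (to v)
    adjacent⇒ u v u~v rewrite toℕ-to u | toℕ-to v =
      Trees.consecutive T p (index≤ u) (index≤ v) (subst₂ (Adj graph) (sym (at-index u)) (sym (at-index v)) u~v)

    successive : ∀ u v → index v ≡ suc (index u) → Adj graph u v
    successive u v eq = subst₂ (Adj graph) (at-index u) (trans (cong (vertex p) (sym eq)) (at-index v))
      (step p (≤-trans (≤-reflexive (sym eq)) (index≤ v)))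

    adjacent⇐ : ∀ u v → Adj (path n) (to u) (to v) → Adj graph u v
    adjacent⇐ u v adj rewrite toℕ-to u | toℕ-to v with adj
    ... | inj₁ eq = successive u v eq
    ... | inj₂ eq = Graph.~-sym graph (successive v u eq)

  exit : ∀ (p : Trail graph) {x z} → Star (Adj graph) x z → x ∈ₜ p → ¬ z ∈ₜ p →
    ∃[ i ] ∃[ b ] i ≤ len p × Adj graph (vertex p i) b × ¬ b ∈ₜ p
  exit p ε x∈p z∉p = contradiction x∈p z∉p
  exit p (_◅_ {j = y} x~y path) (i , i≤ , eq) z∉p with y ∈ₜ? p
  ... | yes y∈p = exit p path y∈p z∉p
  ... | no  y∉p = i , y , i≤ , subst (λ x → Adj graph x y) (sym eq) x~y , y∉p

  -- Both ends being stuck, the exit is at an inner vertex, whose predecessor and successor on the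
  -- trail together with `b` are three distinct neighbours.
  inner-exit⇒branching : ∀ (p : Trail graph) → Stuck p → (∀ v → Adj graph (vertex p (len p)) v → v ∈ₜ p) →
    ∀ i {b} → i ≤ len p → Adj graph (vertex p i) b → ¬ b ∈ₜ p → ∃[ v ] 3 ≤ degree graph v
  inner-exit⇒branching p stuck₀ stuckₙ zero    _  p~b b∉p = contradiction (stuck₀ _ p~b) b∉p
  inner-exit⇒branching p stuck₀ stuckₙ (suc i) {b} i≤ p~b b∉p with m≤n⇒m<n∨m≡n i≤
  ... | inj₂ refl = contradiction (stuckₙ _ p~b) b∉p
  ... | inj₁ i<   = vertex p (suc i) , degree≥3 graph (Graph.~-sym graph (step p i≤)) (step p i<) p~b
    (λ eq → m≢1+m+n i (trans (distinct p (<⇒≤ i≤) i< eq) (cong suc (+-comm 1 i))))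
    (λ eq → b∉p (i , <⇒≤ i≤ , eq))
    (λ eq → b∉p (suc (suc i) , i< , eq))

  -- Maximising, reversing and maximising again gives a trail stuck at both ends. If it misses a
  -- vertex, connectedness yields an edge leaving it.
  branching-or-path : Fin n → (∃[ v ] 3 ≤ degree graph v) ⊎ graph ≅ path n
  branching-or-path v with maximise (single {G = graph} v)
  ... | p , stuck-p , _ with maximise (reverse p)
  ... | q , stuck-q , extends with all? (_∈ₜ? q)
  ... | yes all∈q = inj₂ (hamiltonian⇒path q all∈q)
  ... | no ¬all∈q with ¬∀⟶∃¬ n (_∈ₜ q) (_∈ₜ? q) ¬all∈q
  ... | z , z∉q with exit q (connected (vertex q 0) z) (0 , z≤n , refl) z∉q
  ... | i , b , i≤ , q~b , b∉q = inj₁ (inner-exit⇒branching q stuck-q stuck-end i i≤ q~b b∉q)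
    where
    open Extends extends
    stuck-end : ∀ v → Adj graph (vertex q (len q)) v → v ∈ₜ q
    stuck-end v q~v = covers v (∈-reverse p (stuck-p v
      (subst (λ x → Adj graph x v) (trans same-end (cong (vertex p) (n∸n≡0 (len p)))) q~v)))

-- Transitive targets, paths and the claw

cycle-neighbours : ∀ {n} {G : Graph n} (c : Cycle G) (let open Cycle c) i →
  ∃[ a ] ∃[ b ] a ≢ b × Adj G (vertex i) a × Adj G (vertex i) b
cycle-neighbours {G = G} c zero =
  _ , _ , (λ eq → contradiction (distinct eq) λ ()) , step zero , Graph.~-sym G close
  where open Cycle c
cycle-neighbours {G = G} c (suc j) with view j
... | ‵fromℕ     = _ , _ , (λ eq → contradiction (distinct eq) λ ()) , Graph.~-sym G (step _) , close
  where open Cycle c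
... | ‵inject₁ i = _ , _ , (λ eq → contradiction (cong toℕ (distinct eq)) (skip i)) , Graph.~-sym G (step (inject₁ i)) , step (suc i)
  where
  open Cycle c
  skip : ∀ {n} (i : Fin n) → toℕ (inject₁ (inject₁ i)) ≢ toℕ (Fin.suc (suc i))
  skip i eq = m≢1+m+n (toℕ i) (trans (sym (trans (toℕ-inject₁ (inject₁ i)) (toℕ-inject₁ i))) (trans eq (cong suc (+-comm 1 (toℕ i)))))

leaf∉cycle : ∀ {m} {G : Graph (suc m)} {ℓ} → Leaf G ℓ → (c : Cycle G) → ∀ i → ℓ ≢ Cycle.vertex c i
leaf∉cycle leaf c i refl with cycle-neighbours c i
... | a , b , a≢b , ℓ~a , ℓ~b = a≢b (trans (Leaf.unique leaf a ℓ~a) (sym (Leaf.unique leaf b ℓ~b)))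

delete-cycle : ∀ {m} {G : Graph (suc m)} {ℓ} → Leaf G ℓ → Cycle G → Cycle (delete G ℓ)
delete-cycle {G = G} {ℓ} leaf c = record
  { k        = Cycle.k c
  ; vertex   = λ i → punchOut (ℓ∉ i)
  ; distinct = λ eq → distinct (punchOut-injective (ℓ∉ _) (ℓ∉ _) eq)
  ; step     = λ i → restore (step i)
  ; close    = restore close
  }
  where
  open Cycle c hiding (k)
  ℓ∉ = leaf∉cycle leaf c

  restore : ∀ {i j} → Adj G (vertex i) (vertex j) → Adj G (punchIn ℓ (punchOut (ℓ∉ i))) (punchIn ℓ (punchOut (ℓ∉ j)))
  restore = subst₂ (Adj G) (sym (punchIn-punchOut (ℓ∉ _))) (sym (punchIn-punchOut (ℓ∉ _)))

-- A cycle avoids the leaf `zero`, and deleting that leaf gives a shorter path.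
path-acyclic : ∀ m → ¬ Cycle (path (suc m))
path-acyclic zero c with Cycle.vertex c zero | Cycle.vertex c (suc zero) | Cycle.step c zero
... | zero | zero | inj₁ ()
... | zero | zero | inj₂ ()
path-acyclic (suc m) c = path-acyclic m record
  { k        = Cycle.k c′
  ; vertex   = vertex
  ; distinct = distinct
  ; step     = λ i → Sum.map suc-injective suc-injective (step i)
  ; close    = Sum.map suc-injective suc-injective close
  }
  where
  c′ = delete-cycle (path-leaf m) c
  open Cycle c′ hiding (k)

star-from⇒connected : ∀ {n} (G : Graph n) u → (∀ v → Star (Adj G) u v) → Connected G
star-from⇒connected G u reach v w = Closure.reverse (Graph.~-sym G) (reach v) ◅◅ reach w

pathTree : ∀ m → Tree (suc m)
pathTree m = record
  { graph     = path (suc m)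
  ; loopless  = λ { v (inj₁ eq) → m≢1+n+m (toℕ v) {0} eq ; v (inj₂ eq) → m≢1+n+m (toℕ v) {0} eq }
  ; connected = star-from⇒connected (path (suc m)) zero
      (<-weakInduction (Star (Adj (path (suc m))) zero) ε λ i reach →
        reach ◅◅ (inj₁ (cong suc (sym (toℕ-inject₁ i))) ◅ ε))
  ; acyclic   = path-acyclic m
  }

-- The star with three leaves and centre `zero`, the smallest tree that is not a path; it refutes
-- strictness for transitive targets.
claw : Graph 4
claw = record
  { _~_   = λ u v → (u ≡ zero × v ≢ zero) ⊎ (v ≡ zero × u ≢ zero)
  ; ~-sym = Sum.swap
  ; _~?_  = λ u v → (u ≟ᶠ zero ×-dec ¬? (v ≟ᶠ zero)) ⊎-dec (v ≟ᶠ zero ×-dec ¬? (u ≟ᶠ zero))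
  }

clawTree : Tree 4
clawTree = record
  { graph     = claw
  ; loopless  = λ { v (inj₁ (v≡0 , v≢0)) → v≢0 v≡0 ; v (inj₂ (v≡0 , v≢0)) → v≢0 v≡0 }
  ; connected = star-from⇒connected claw zero λ { zero → ε ; (suc v) → inj₁ (refl , λ ()) ◅ ε }
  ; acyclic   = acyclic
  }
  where
  -- A vertex on a cycle has two distinct neighbours, whereas a leaf of the claw has only the
  -- centre.
  centre∈cycle : ∀ (c : Cycle claw) i → Cycle.vertex c i ≡ zero
  centre∈cycle c i with Cycle.vertex c i ≟ᶠ zero | cycle-neighbours c i
  ... | yes v≡0 | _ = v≡0
  ... | no  v≢0 | a , b , a≢b , inj₁ (v≡0 , _) , _ = contradiction v≡0 v≢0
  ... | no  v≢0 | a , b , a≢b , inj₂ _ , inj₁ (v≡0 , _) = contradiction v≡0 v≢0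
  ... | no  v≢0 | a , b , a≢b , inj₂ (a≡0 , _) , inj₂ (b≡0 , _) = contradiction (trans a≡0 (sym b≡0)) a≢b

  acyclic : ¬ Cycle claw
  acyclic c with Cycle.distinct c (trans (centre∈cycle c zero) (sym (centre∈cycle c (suc zero))))
  ... | ()

-- Each neighbour is the predecessor or the successor of `v`, so two of the three are on the same
-- side.
path-neighbours : ∀ {n} {v a b c : Fin n} → Adj (path n) v a → Adj (path n) v b → Adj (path n) v c →
  a ≡ b ⊎ a ≡ c ⊎ b ≡ c
path-neighbours (inj₁ p) (inj₁ q) _        = inj₁ (toℕ-injective (trans p (sym q)))
path-neighbours (inj₂ p) (inj₂ q) _        = inj₁ (toℕ-injective (suc-injective (trans (sym p) q)))
path-neighbours (inj₁ p) (inj₂ q) (inj₁ r) = inj₂ (inj₁ (toℕ-injective (trans p (sym r))))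
path-neighbours (inj₁ p) (inj₂ q) (inj₂ r) = inj₂ (inj₂ (toℕ-injective (suc-injective (trans (sym q) r))))
path-neighbours (inj₂ p) (inj₁ q) (inj₁ r) = inj₂ (inj₂ (toℕ-injective (trans q (sym r))))
path-neighbours (inj₂ p) (inj₁ q) (inj₂ r) = inj₂ (inj₁ (toℕ-injective (suc-injective (trans (sym p) r))))

claw≇path : ¬ claw ≅ path 4
claw≇path claw≅path =
  coincide (path-neighbours (neighbour zero) (neighbour (suc zero)) (neighbour (suc (suc zero))))
  where
  open _≅_ claw≅path
  open Inverse bijection using (to)

  neighbour : ∀ i → Adj (path 4) (to zero) (to (suc i))
  neighbour i = Equivalence.to (adjacency zero (suc i)) (inj₁ (refl , λ ()))

  coincide : ¬ (to (suc zero) ≡ to (suc (suc zero)) ⊎ to (suc zero) ≡ to (suc (suc (suc zero)))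
                ⊎ to (suc (suc zero)) ≡ to (suc (suc (suc zero))))
  coincide (inj₁ eq)        = contradiction (Injection.injective (↔⇒↣ bijection) eq) λ ()
  coincide (inj₂ (inj₁ eq)) = contradiction (Injection.injective (↔⇒↣ bijection) eq) λ ()
  coincide (inj₂ (inj₂ eq)) = contradiction (Injection.injective (↔⇒↣ bijection) eq) λ ()

-- Transitivity of adjacency in the target and the two halves of the theorem

module _ {k} (H : Graph k) where

  transitive-or-not : Transitive (Adj H) ⊎ (∃[ x ] ∃[ y ] ∃[ z ] Adj H x y × Adj H y z × ¬ Adj H x z)
  transitive-or-not with any? (λ x → any? λ y → any? λ z → adj? H x y ×-dec adj? H y z ×-dec ¬? (adj? H x z))
  ... | yes (x , y , z , found) = inj₂ (x , y , z , found)
  ... | no none = inj₁ λ {x} {y} {z} x~y y~z →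
    decidable-stable (adj? H x z) λ x≁z → none (x , y , z , x~y , y~z , x≁z)

  -- Along walks, transitivity makes the colours of any two vertices adjacent, so being a colouring
  -- is a condition that does not mention the tree.
  transitive⇒hom≡ : Transitive (Adj H) → ∀ {m} (S T : Tree (suc (suc m))) → hom (Tree.graph S) H ≡ hom (Tree.graph T) H
  transitive⇒hom≡ ~-trans {m} S T = Colourings.hom-cong H (Tree.graph S) (Tree.graph T)
    (λ f col u v _ → complete S f col u v) (λ f col u v _ → complete T f col u v)
    where
    complete : ∀ (T : Tree (suc (suc m))) f → IsColoring (Tree.graph T) H f → ∀ u v → Adj H (f u) (f v)
    complete T f col u v =
      -- A first edge at `u`, available since there are at least two vertices, keeps the walk
      -- nonempty even when `v` is `u`.
      let w , u~w = has-neighbour T u in along (col u w u~w) (Tree.connected T w v)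
      where
      along : ∀ {w v} → Adj H (f u) (f w) → Star (Adj (Tree.graph T)) w v → Adj H (f u) (f v)
      along fu~fw ε             = fu~fw
      along fu~fw (w~x ◅ path)  = along (~-trans fu~fw (col _ _ w~x)) path

  nonIsolated-index : ∀ {v} → ¬ Isolated H v → ∃[ i ] lookup (nonIsolated H) i ≡ v
  nonIsolated-index {v} ¬iso = Any.index v∈ , sym (lookup-index v∈)
    where
    v∈ : v ∈ nonIsolated H
    v∈ = ∈-filter⁺ (¬? ∘ isolated? H) (∈-allFin v) ¬iso

  adjacent-index : ∀ {u v} → Adj H u v → u ≢ v → ∃[ i ] lookup (nonIsolated H) i ≡ u
  adjacent-index u~v u≢v = nonIsolated-index λ iso → u≢v (sym (iso _ u~v))

  -- An edge between distinct vertices has both ends non-isolated and would survive the removal, so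
  -- every edge of `H` is a loop.
  empty⇒transitive : Empty (removeIsolated H) → Transitive (Adj H)
  empty⇒transitive empty {x} {y} x~y y~z with x ≟ᶠ y
  ... | yes refl = y~z
  ... | no x≢y with adjacent-index x~y x≢y | adjacent-index (Graph.~-sym H x~y) (x≢y ∘ sym)
  ... | i , refl | j , refl = contradiction x~y (empty i j)

  -- Unless one of the two edges is a loop, `x` and `z` are both non-isolated; they may coincide,
  -- and then the loop is what is required.
  complete⇒transitive : FullyLoopedComplete (removeIsolated H) → Transitive (Adj H)
  complete⇒transitive (adjacent , looped) {x} {y} {z} x~y y~z with x ≟ᶠ y | y ≟ᶠ z
  ... | yes refl | _        = y~z
  ... | no _     | yes refl = x~y
  ... | no x≢y   | no y≢z with adjacent-index x~y x≢y | adjacent-index (Graph.~-sym H y~z) (y≢z ∘ sym)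
  ... | i , refl | j , refl with i ≟ᶠ j
  ... | yes refl = looped i
  ... | no i≢j   = adjacent i j i≢j

  nonIsolated⇒neighbour : ∀ {v} → ¬ Isolated H v → ∃[ w ] Adj H v w
  nonIsolated⇒neighbour {v} ¬iso with any? (adj? H v)
  ... | yes found = found
  ... | no none   = contradiction (λ w v~w → contradiction (w , v~w) none) ¬iso

  -- By nestedness, a neighbour of the vertex with the smaller neighbourhood is a common neighbour,
  -- and transitivity joins the two vertices through it.
  transitive⇒complete : Nested H → Transitive (Adj H) → FullyLoopedComplete (removeIsolated H)
  transitive⇒complete nested ~-trans = (λ i j _ → adjacent i j) , (λ i → adjacent i i)
    where
    neighbour : ∀ i → ∃[ w ] Adj H (lookup (nonIsolated H) i) w
    neighbour i = nonIsolated⇒neighbour (proj₂ (∈-filter⁻ (¬? ∘ isolated? H) {xs = allFin k} (∈-lookup i)))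

    adjacent : ∀ i j → Adj (removeIsolated H) i j
    adjacent i j with neighbour i | neighbour j | nested (lookup (nonIsolated H) i) (lookup (nonIsolated H) j)
    ... | w , i~w | _       | inj₁ i⊑j = ~-trans i~w (Graph.~-sym H (i⊑j w i~w))
    ... | _       | w , j~w | inj₂ j⊑i = ~-trans (j⊑i w j~w) (Graph.~-sym H j~w)

  nested⇒hoffmanLondon : Nested H → HoffmanLondon H
  nested⇒hoffmanLondon nested (suc m) _ = (pathTree m , refl) , λ T →
    -- Any centre would do for the weak inequality; `zero` exists in every tree with `suc m`
    -- vertices.
    let ls , span≡m , _ , spider≤hom = spider-bound T zero in begin
      hom (path (suc m)) H     ≡⟨ hom-path m ⟩
      ∑ (walks m)              ≡⟨ cong (∑ ∘ walks) span≡m ⟨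
      ∑ (walks (span ls))      ≤⟨ walks≤spider ls ⟩
      ∑ (spider ls)            ≤⟨ spider≤hom ⟩
      hom (Tree.graph T) H     ∎
    where
    open ≤-Reasoning
    open Walks H
    open Spiders H nested
    open SpiderBound H nested
    open PathColourings H

  nontransitive⇒strongly : Nested H → ∀ {x y z} → Adj H x y → Adj H y z → ¬ Adj H x z → StronglyHoffmanLondon H
  nontransitive⇒strongly nested x~y y~z x≁z (suc m) _ T T≇path =
    Sum.[ branching , (λ T≅path → contradiction T≅path T≇path) ]′ (branching-or-path T zero)
    where
    open ≤-Reasoning
    open Walks H
    open Spiders H nested
    open SpiderBound H nested
    open PathColourings H

    branching : (∃[ v ] 3 ≤ degree (Tree.graph T) v) → hom (path (suc m)) H < hom (Tree.graph T) H
    branching (v , 3≤degree) =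
      let ls , span≡m , length≡degree , spider≤hom = spider-bound T v in begin-strict
        hom (path (suc m)) H     ≡⟨ hom-path m ⟩
        ∑ (walks m)              ≡⟨ cong (∑ ∘ walks) span≡m ⟨
        ∑ (walks (span ls))      <⟨ walks<spider x~y y~z x≁z ls (subst (3 ≤_) (sym length≡degree) 3≤degree) ⟩
        ∑ (spider ls)            ≤⟨ spider≤hom ⟩
        hom (Tree.graph T) H     ∎

  strongly⇒nontransitive : StronglyHoffmanLondon H → ¬ Transitive (Adj H)
  strongly⇒nontransitive strongly ~-trans =
    <⇒≢ (strongly 4 (s≤s z≤n) clawTree claw≇path) (transitive⇒hom≡ ~-trans (pathTree 3) clawTree)

theorem4p10 : ∀ {n : ℕ} (H : Graph n) → LoopThreshold H →
    HoffmanLondon H ×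
    (StronglyHoffmanLondon H ⇔
    (¬ Empty (removeIsolated H) × ¬ FullyLoopedComplete (removeIsolated H)))
theorem4p10 H loopThreshold = nested⇒hoffmanLondon H nested , mk⇔
  (λ strongly → strongly⇒nontransitive H strongly ∘ empty⇒transitive H ,
                strongly⇒nontransitive H strongly ∘ complete⇒transitive H)
  (λ (_ , ¬complete) → strongly ¬complete (transitive-or-not H))
  where
  nested = loopThreshold⇒nested loopThreshold

  strongly : ¬ FullyLoopedComplete (removeIsolated H) →
    Transitive (Adj H) ⊎ (∃[ x ] ∃[ y ] ∃[ z ] Adj H x y × Adj H y z × ¬ Adj H x z) → StronglyHoffmanLondon H
  strongly ¬complete (inj₁ ~-trans) = contradiction (transitive⇒complete H nested ~-trans) ¬complete
  strongly _ (inj₂ (_ , _ , _ , x~y , y~z , x≁z)) = nontransitive⇒strongly H nested x~y y~z x≁z
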